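{- Let $t \ge 4$ be a rational number, let $G$ be a $t$-tough graph on $n \ge 3$ vertices, and let $x, y \in V(G)$ be distinct non-adjacent vertices with $\deg(x) + \deg(y) \ge n - t$. Then $G$ is Hamiltonian if and only if $G + xy$ is Hamiltonian.
   Context: Graphs are simple, undirected and finite. Let $c(H)$ denote the number of components of a graph $H$. For a real number $t \ge 0$, $G$ is $t$-tough if $|S| \ge t \cdot c(G-S)$ for all $S \subseteq V(G)$ with $c(G-S) \ge 2$ (so complete graphs are $t$-tough for every $t$). For non-adjacent vertices $x, y$, $G+xy$ is the graph obtained from $G$ by adding the edge $xy$. Degrees $\deg(x),\deg(y)$ are taken in $G$. A graph is Hamiltonian if it has a cycle containing all its vertices. -}

module Defs where

open import Data.Fin using (Fin; zero; suc)
open import Data.Fin.Properties using (_≟_; any?; suc-injective; injective⇒≤)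
open import Data.Fin.Subset using (Subset; inside; outside; ∣_∣; ∁)
open import Data.Integer using (+_)
open import Data.List using (List; _∷_; _∷ʳ_; length; filter; allFin)
open import Data.List.Membership.Propositional using (_∈_)
open import Data.List.Relation.Unary.Linked using (Linked)
open import Data.List.Relation.Unary.Unique.Propositional using (Unique)
open import Data.Nat using (ℕ; zero; suc)
import Data.Nat as ℕ
import Data.Nat.Properties as ℕ
open import Data.Product using (∃; _×_; _,_; proj₁; proj₂; swap)
open import Data.Rational using (ℚ; _/_; _≤_; _*_)
open import Data.Sum using (_⊎_; inj₁; inj₂)
open import Data.Vec using ([]; _∷_)
open import Function using (id; _on_; _⇔_; mk⇔; Equivalence; Surjective)
open import Level using (0ℓ)
open import Relation.Binary using (Rel; Decidable; Symmetric; Irreflexive; IsDecEquivalence)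
open import Relation.Binary.Construct.Closure.ReflexiveTransitive using (Star; ε; _◅_; _◅◅_; gmap; reverse)
open import Relation.Binary.PropositionalEquality using (_≡_; _≢_; refl; sym; trans; cong)
open import Relation.Nullary using (¬_; Dec; yes; no; contradiction)
open import Relation.Nullary.Decidable using (map′; _×-dec_; _⊎-dec_)

private variable
  n j k : ℕ

record Graph (n : ℕ) : Set₁ where
  infix 4 _~_ _~?_
  field
    _~_      : Rel (Fin n) 0ℓ
    _~?_     : Decidable _~_
    ~-sym    : Symmetric _~_
    ~-irrefl : Irreflexive _≡_ _~_

open Graph public using (~-sym; ~-irrefl)

deg : Graph n → Fin n → ℕ
deg {n} G v = length (filter (v ~?_) (allFin n))
  where open Graph G

addEdge : (G : Graph n) (x y : Fin n) → x ≢ y → Graph n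
addEdge {n} G x y x≢y = record
  { _~_      = λ u v → u ~ v ⊎ (u ≡ x × v ≡ y) ⊎ (u ≡ y × v ≡ x)
  ; _~?_     = λ u v → (u ~? v) ⊎-dec ((u ≟ x) ×-dec (v ≟ y)) ⊎-dec ((u ≟ y) ×-dec (v ≟ x))
  ; ~-sym    = λ { (inj₁ e)        → inj₁ (~-sym G e)
                 ; (inj₂ (inj₁ p)) → inj₂ (inj₂ (swap p))
                 ; (inj₂ (inj₂ p)) → inj₂ (inj₁ (swap p)) }
  ; ~-irrefl = λ { refl (inj₁ e)                → ~-irrefl G refl e
                 ; refl (inj₂ (inj₁ (ux , uy))) → x≢y (trans (sym ux) uy)
                 ; refl (inj₂ (inj₂ (uy , ux))) → x≢y (trans (sym ux) uy) }
  }
  where open Graph G using (_~_; _~?_)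

-- The increasing enumeration of the elements of a subset.
element : (p : Subset n) → Fin ∣ p ∣ → Fin n
element (outside ∷ p) i       = suc (element p i)
element (inside  ∷ p) zero    = zero
element (inside  ∷ p) (suc i) = suc (element p i)

element-injective : (p : Subset n) {i j : Fin ∣ p ∣} → element p i ≡ element p j → i ≡ j
element-injective (outside ∷ p) eq = element-injective p (suc-injective eq)
element-injective (inside  ∷ p) {zero}  {zero}  eq = refl
element-injective (inside  ∷ p) {suc i} {suc j} eq = cong suc (element-injective p (suc-injective eq))

induced : Graph n → (p : Subset n) → Graph ∣ p ∣
induced G p = record
  { _~_      = _~_ on element p
  ; _~?_     = λ i j → element p i ~? element p j
  ; ~-sym    = ~-sym G
  ; ~-irrefl = λ i≡j → ~-irrefl G (cong (element p) i≡j)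
  }
  where open Graph G using (_~_; _~?_)

infixl 6 _─_

_─_ : Graph n → (S : Subset n) → Graph ∣ ∁ S ∣
G ─ S = induced G (∁ S)

Connected : Graph n → Rel (Fin n) 0ℓ
Connected G = Star (Graph._~_ G)

-- G has exactly k components: the classes of Connected G are in bijection
-- with Fin k.
record Components (G : Graph n) (k : ℕ) : Set where
  field
    component      : Fin n → Fin k
    surjective     : Surjective _≡_ _≡_ component
    same⇔connected : ∀ {u v} → component u ≡ component v ⇔ Connected G u v

Components-≤ : (G : Graph n) → Components G j → Components G k → j ℕ.≤ k
Components-≤ {j = j} {k = k} G C D = injective⇒≤ {f = f} f-injective
  where
  module C = Components C
  module D = Components D
  rep : Fin j → Fin _
  rep i = proj₁ (C.surjective i)
  rep-component : ∀ i → C.component (rep i) ≡ i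
  rep-component i = proj₂ (C.surjective i) refl
  f : Fin j → Fin k
  f i = D.component (rep i)
  f-injective : ∀ {a b} → f a ≡ f b → a ≡ b
  f-injective {a} {b} eq = trans (sym (rep-component a))
    (trans (Equivalence.from C.same⇔connected (Equivalence.to D.same⇔connected eq))
           (rep-component b))

Components-unique : (G : Graph n) → Components G j → Components G k → j ≡ k
Components-unique G C D = ℕ.≤-antisym (Components-≤ G C D) (Components-≤ G D C)

-- By induction on the number of vertices: a walk either avoids the vertex
-- zero, or both of its ends are joined to zero.
connected? : (G : Graph n) → Decidable (Connected G)
connected? {suc n} G u v = map′ sound complete (joined? u v)
  where
  open Graph G using (_~_; _~?_)

  G′ : Graph n
  G′ = record
    { _~_      = _~_ on suc
    ; _~?_     = λ i j → suc i ~? suc j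
    ; ~-sym    = ~-sym G
    ; ~-irrefl = λ i≡j → ~-irrefl G (cong suc i≡j)
    }

  Avoiding : Rel (Fin (suc n)) 0ℓ
  Avoiding a b = ∃ λ i → ∃ λ j → a ≡ suc i × b ≡ suc j × Connected G′ i j

  avoiding? : Decidable Avoiding
  avoiding? zero    b       = no λ { (_ , _ , () , _) }
  avoiding? (suc i) zero    = no λ { (_ , _ , _ , () , _) }
  avoiding? (suc i) (suc j) = map′ (λ w → i , j , refl , refl , w)
    (λ { (_ , _ , refl , refl , w) → w }) (connected? G′ i j)

  Touches : Fin (suc n) → Set
  Touches a = a ≡ zero ⊎ ∃ λ i → zero ~ suc i × Avoiding (suc i) a

  touches? : ∀ a → Dec (Touches a)
  touches? a = (a ≟ zero) ⊎-dec any? (λ i → (zero ~? suc i) ×-dec avoiding? (suc i) a)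

  Joined : Rel (Fin (suc n)) 0ℓ
  Joined a b = Avoiding a b ⊎ (Touches a × Touches b)

  joined? : Decidable Joined
  joined? a b = avoiding? a b ⊎-dec (touches? a ×-dec touches? b)

  avoiding⇒ : ∀ {a b} → Avoiding a b → Connected G a b
  avoiding⇒ (_ , _ , refl , refl , w) = gmap suc id w

  touches⇒ : ∀ {a} → Touches a → Connected G zero a
  touches⇒ (inj₁ refl)        = ε
  touches⇒ (inj₂ (i , e , w)) = e ◅ avoiding⇒ w

  sound : ∀ {a b} → Joined a b → Connected G a b
  sound (inj₁ w)       = avoiding⇒ w
  sound (inj₂ (p , q)) = reverse (~-sym G) (touches⇒ p) ◅◅ touches⇒ q

  touches-step : ∀ {a b} → a ~ b → Touches b → Touches a
  touches-step {zero}          e _           = inj₁ refl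
  touches-step {suc a} {zero}  e _           = inj₂ (a , ~-sym G e , a , a , refl , refl , ε)
  touches-step {suc a} {suc b} e (inj₂ (i , d , _ , _ , refl , refl , w)) =
    inj₂ (i , d , _ , a , refl , refl , w ◅◅ (~-sym G e ◅ ε))

  step : ∀ {a b c} → a ~ b → Joined b c → Joined a c
  step {zero}  e (inj₁ (i , j , refl , refl , w)) =
    inj₂ (inj₁ refl , inj₂ (i , e , i , j , refl , refl , w))
  step {suc a} e (inj₁ (i , j , refl , refl , w)) = inj₁ (a , j , refl , refl , e ◅ w)
  step         e (inj₂ (p , q))                   = inj₂ (touches-step e p , q)

  joined-refl : ∀ a → Joined a a
  joined-refl zero    = inj₂ (inj₁ refl , inj₁ refl)
  joined-refl (suc i) = inj₁ (i , i , refl , refl , ε)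

  complete : ∀ {a b} → Connected G a b → Joined a b
  complete ε       = joined-refl _
  complete (e ◅ w) = step e (complete w)

private
  Classes : Rel (Fin n) 0ℓ → ℕ → Set
  Classes {n} _≈_ k = ∃ λ (f : Fin n → Fin k) →
    Surjective _≡_ _≡_ f × (∀ {u v} → f u ≡ f v ⇔ u ≈ v)

  classes : (_≈_ : Rel (Fin n) 0ℓ) → IsDecEquivalence _≈_ → ∃ (Classes _≈_)
  classes {zero}  _≈_ eqv = 0 , (λ ()) , (λ ()) , λ { {()} }
  classes {suc n} _≈_ eqv
    with classes (_≈_ on suc) (record
           { isEquivalence = record { refl = E.refl ; sym = E.sym ; trans = E.trans }
           ; _≟_ = λ i j → suc i E.≟ suc j })
       | any? (λ i → zero E.≟ suc i)
    where module E = IsDecEquivalence eqv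
  ... | k , f , f-surj , f-eq | yes (r , z≈r) = k , g , g-surj , g-eq
    where
    module E = IsDecEquivalence eqv
    g : Fin (suc n) → Fin k
    g zero    = f r
    g (suc i) = f i
    g-surj : Surjective _≡_ _≡_ g
    g-surj y = suc (proj₁ (f-surj y)) , λ { refl → proj₂ (f-surj y) refl }
    g-eq : ∀ {u v} → g u ≡ g v ⇔ u ≈ v
    g-eq {zero}  {zero}  = mk⇔ (λ _ → E.refl) (λ _ → refl)
    g-eq {zero}  {suc v} = mk⇔ (λ e → E.trans z≈r (Equivalence.to f-eq e))
                               (λ e → Equivalence.from f-eq (E.trans (E.sym z≈r) e))
    g-eq {suc u} {zero}  = mk⇔ (λ e → E.trans (Equivalence.to f-eq e) (E.sym z≈r))
                               (λ e → Equivalence.from f-eq (E.trans e z≈r))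
    g-eq {suc u} {suc v} = f-eq
  ... | k , f , f-surj , f-eq | no z≉ = suc k , g , g-surj , g-eq
    where
    module E = IsDecEquivalence eqv
    g : Fin (suc n) → Fin (suc k)
    g zero    = zero
    g (suc i) = suc (f i)
    g-surj : Surjective _≡_ _≡_ g
    g-surj zero    = zero , λ { refl → refl }
    g-surj (suc y) = suc (proj₁ (f-surj y)) , λ { refl → cong suc (proj₂ (f-surj y) refl) }
    g-eq : ∀ {u v} → g u ≡ g v ⇔ u ≈ v
    g-eq {zero}  {zero}  = mk⇔ (λ _ → E.refl) (λ _ → refl)
    g-eq {zero}  {suc v} = mk⇔ (λ ()) (λ e → contradiction (v , e) z≉)
    g-eq {suc u} {zero}  = mk⇔ (λ ()) (λ e → contradiction (u , E.sym e) z≉)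
    g-eq {suc u} {suc v} = mk⇔ (λ e → Equivalence.to f-eq (suc-injective e))
                               (λ e → cong suc (Equivalence.from f-eq e))

components : (G : Graph n) → ∃ (Components G)
components G with classes (Connected G) (record
  { isEquivalence = record { refl = ε ; sym = reverse (~-sym G) ; trans = _◅◅_ }
  ; _≟_ = connected? G })
... | k , f , f-surj , f-eq = k , record
  { component = f ; surjective = f-surj ; same⇔connected = f-eq }

c : Graph n → ℕ
c G = proj₁ (components G)

fromℕ : ℕ → ℚ
fromℕ k = + k / 1

Tough : ℚ → Graph n → Set
Tough {n} t G = (S : Subset n) → 2 ℕ.≤ c (G ─ S) → t * fromℕ (c (G ─ S)) ≤ fromℕ ∣ S ∣

-- The cycle v, v₁, …, vₗ, v with rest = v₁ ∷ … ∷ vₗ.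
record Cycle (G : Graph n) : Set where
  field
    start    : Fin n
    rest     : List (Fin n)
    closed   : Linked (Graph._~_ G) (start ∷ rest ∷ʳ start)
    distinct : Unique (start ∷ rest)
    length≥3 : 3 ℕ.≤ length (start ∷ rest)

  vertices : List (Fin n)
  vertices = start ∷ rest

Hamiltonian : Graph n → Set
Hamiltonian {n} G = ∃ λ (C : Cycle G) → (v : Fin n) → v ∈ Cycle.vertices C

module Submission where

-- If G is not Hamiltonian but G + xy is, then G has a Hamiltonian path x = v_0, …, v_N = y.  Label its
-- edge v_k v_{k+1} by X if x ~ v_{k+1} and by Y if y ~ v_k.  No edge has both labels, and the degree
-- condition leaves at most t − 1 edges unlabelled.  Rotating the path forbids many chords.
--
-- Suppose that r > 0 vertices lie between an edge labelled Y and an edge labelled X.  They are pairwise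
-- non-adjacent and their neighbours lie next to common non-neighbours of x and y.  No two consecutive
-- vertices on the same side of these r vertices are both neighbours of them.  So if o edges are
-- unlabelled, there are at most 2 r + 2 o neighbours, and only 2 + o when r = 1.  Deleting them leaves
-- at least r + 1 components, against toughness.
--
-- If there is no such vertex, let A be the set of left ends of the X-edges and B the set of right ends
-- of the Y-edges.  At most o + 1 vertices lie outside A ∪ B, and every edge between A and B joins some
-- v_i in A to an earlier vertex of B.  The edge entering such a v_i is unlabelled, as otherwise v_{i-1}
-- would have at most 2 o + 1 < 2 t neighbours.  So 2 o + 1 < 2 t vertices separate x from y.

open import Defs
open import Data.Bool using (true; false; not; if_then_else_)
open import Data.Empty using (⊥; ⊥-elim)
open import Data.Fin using (Fin; zero; suc; toℕ)
open import Data.Fin.Properties using (_≟_; any?; all?; injective⇒≤; toℕ<n; toℕ-injective)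
open import Data.Fin.Subset using (Subset; inside; outside; ∣_∣; ∁)
import Data.Integer as ℤ
import Data.Integer.Properties as ℤ
open import Data.List using (List; []; _∷_; _++_; _∷ʳ_; length; lookup; map; filter; reverse; downFrom; allFin)
open import Data.List.Membership.Propositional using (_∈_)
import Data.List.Membership.DecPropositional as DecMembership
open import Data.List.Membership.Propositional.Properties
  using (∈-lookup; ∈-++⁺ˡ; ∈-++⁺ʳ; ∈-++⁻; ∈-map⁺; ∈-filter⁺; ∈-filter⁻; ∈-downFrom⁺; ∈-downFrom⁻)
import Data.List.Properties as List
import Data.List.Relation.Unary.All as All
import Data.List.Relation.Unary.All.Properties as All
open import Data.List.Relation.Unary.AllPairs using ([]; _∷_)
open import Data.List.Relation.Unary.Any using (here; there; index)
open import Data.List.Relation.Unary.Any.Properties using (lookup-index)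
import Data.List.Relation.Unary.Linked as Linked
open import Data.List.Relation.Unary.Linked using (Linked; [-]; _∷_; linked?)
import Data.List.Relation.Unary.Unique.DecPropositional as DecUnique
open import Data.List.Relation.Unary.Unique.Propositional using (Unique)
import Data.List.Relation.Unary.Unique.Propositional.Properties as Unique
open import Data.List.Relation.Binary.Permutation.Propositional
  using (_↭_; ↭-refl; ↭-sym; ↭-trans; ↭-reflexive; ↭⇒↭ₛ)
open import Data.List.Relation.Binary.Permutation.Propositional.Properties
  using (∈-resp-↭; ↭-reverse; ++⁺; ++⁺ˡ; ++-comm; shifts)
import Data.List.Relation.Binary.Permutation.Setoid.Properties as SetoidPermutation
open import Data.Nat using (ℕ; zero; suc; pred; _+_; _*_; _∸_; _≤_; _<_; _≤?_; _<?_; z≤n; s≤s; s≤s⁻¹;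
                            _≤‴_; ≤‴-refl; ≤‴-reflexive; ≤‴-step)
import Data.Nat as ℕ
open import Data.Nat.Properties hiding (_≟_)
open import Data.Nat.Tactic.RingSolver using (solve-∀)
open import Data.Product using (∃; _×_; _,_; proj₁; proj₂)
open import Data.Rational using (ℚ; _≥_; _-_; 0ℚ; NonNegative; toℚᵘ)
import Data.Rational as ℚ
import Data.Rational.Properties as ℚ
open import Data.Rational.Unnormalised using (ℚᵘ; mkℚᵘ; *≤*; _≃_)
import Data.Rational.Unnormalised as ℚᵘ
import Data.Rational.Unnormalised.Properties as ℚᵘ
open import Data.Sum using (_⊎_; inj₁; inj₂)
import Data.Vec as Vec
open Vec using ([]; _∷_)
open import Data.Vec.Properties using (lookup∘tabulate; lookup-map)
open import Function using (_⇔_; mk⇔; _∘_; Equivalence)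
open import Relation.Binary using (tri<; tri≈; tri>)
open import Relation.Binary.Construct.Closure.ReflexiveTransitive using (ε; _◅_)
open import Relation.Binary.PropositionalEquality
open import Relation.Nullary using (¬_; Dec; yes; no; does; contradiction)
open import Relation.Nullary.Decidable
  using (map′; dec-true; dec-false; decidable-stable; ¬?; _×-dec_; _⊎-dec_)
import Relation.Unary as U

-- Counting and components

injective-into-≤ : ∀ {A : Set} {k} (f : Fin k → A) → (∀ {i j} → f i ≡ f j → i ≡ j) →
                   (ys : List A) → (∀ i → f i ∈ ys) → k ≤ length ys
injective-into-≤ f inj ys f∈ = injective⇒≤ {f = index ∘ f∈} λ {i} {j} eq →
  inj (trans (lookup-index (f∈ i)) (trans (cong (lookup ys) eq) (sym (lookup-index (f∈ j)))))

lookup-injective : ∀ {A : Set} {xs : List A} → Unique xs → ∀ {i j} → lookup xs i ≡ lookup xs j → i ≡ j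
lookup-injective (_ ∷ _)  {zero}  {zero}  _  = refl
lookup-injective (p ∷ _)  {zero}  {suc j} eq = contradiction eq (All.lookup p (∈-lookup j))
lookup-injective (p ∷ _)  {suc i} {zero}  eq = contradiction (sym eq) (All.lookup p (∈-lookup i))
lookup-injective (_ ∷ ps) {suc i} {suc j} eq = cong suc (lookup-injective ps eq)

Unique-⊆-length : ∀ {A : Set} {xs ys : List A} → Unique xs → (∀ {x} → x ∈ xs → x ∈ ys) → length xs ≤ length ys
Unique-⊆-length {xs = xs} {ys} u sub =
  injective-into-≤ (lookup xs) (lookup-injective u) ys (sub ∘ ∈-lookup)

module _ {n : ℕ} where

  comprehension : {P : Fin n → Set} → U.Decidable P → Subset n
  comprehension P? = Vec.tabulate (does ∘ P?)

  lookup-element : ∀ {m} (p : Subset m) i → Vec.lookup p (element p i) ≡ inside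
  lookup-element (outside ∷ p) i       = lookup-element p i
  lookup-element (inside  ∷ p) zero    = refl
  lookup-element (inside  ∷ p) (suc i) = lookup-element p i

  element-surjective : ∀ {m} (p : Subset m) u → Vec.lookup p u ≡ inside → ∃ λ i → element p i ≡ u
  element-surjective (inside  ∷ p) zero    _ = zero , refl
  element-surjective (outside ∷ p) (suc u) e with element-surjective p u e
  ... | i , eq = i , cong suc eq
  element-surjective (inside  ∷ p) (suc u) e with element-surjective p u e
  ... | i , eq = suc i , cong suc eq

  module _ {P : Fin n → Set} (P? : U.Decidable P) where

    element-comprehension : ∀ i → P (element (comprehension P?) i)
    element-comprehension i with P? (element (comprehension P?) i)
                          | trans (sym (lookup∘tabulate (does ∘ P?) _)) (lookup-element (comprehension P?) i)
    ... | yes p | _  = p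
    ... | no  _ | ()

    element-∁ : ∀ i → ¬ P (element (∁ (comprehension P?)) i)
    element-∁ i p with trans (sym (lookup-element (∁ (comprehension P?)) i))
                      (trans (lookup-map _ not (comprehension P?))
                      (cong not (trans (lookup∘tabulate (does ∘ P?) _) (dec-true (P? _) p))))
    ... | ()

    element-∁-surjective : ∀ u → ¬ P u → ∃ λ i → element (∁ (comprehension P?)) i ≡ u
    element-∁-surjective u ¬p = element-surjective (∁ (comprehension P?)) u
      (trans (lookup-map u not (comprehension P?))
             (cong not (trans (lookup∘tabulate (does ∘ P?) u) (dec-false (P? u) ¬p))))

    ∣comprehension∣-≤ : ∀ ys → (∀ u → P u → u ∈ ys) → ∣ comprehension P? ∣ ≤ length ys
    ∣comprehension∣-≤ ys sub = injective-into-≤ (element (comprehension P?)) (element-injective (comprehension P?)) ys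
      (λ i → sub _ (element-comprehension i))

    module _ (G : Graph n) where
      open Graph G using (_~_)

      -- A certificate that `u` and `w` lie in different components once `P` is deleted. It speaks
      -- of vertices of `G`, which keeps the indices of the induced graph out of the combinatorics.
      record Separated (u w : Fin n) : Set₁ where
        constructor separatedBy
        field
          Side   : Fin n → Set
          near   : Side u
          far    : ¬ Side w
          closed : ∀ {a b} → Side a → ¬ P a → ¬ P b → a ~ b → Side b

      Separated⇒¬Connected : ∀ {i j} → Separated (element (∁ (comprehension P?)) i) (element (∁ (comprehension P?)) j) →
                             ¬ Connected (G ─ comprehension P?) i j
      Separated⇒¬Connected (separatedBy Q q ¬q closed) w = ¬q (along w q)
        where
        along : ∀ {i j} → Connected (G ─ comprehension P?) i j →
                Q (element (∁ (comprehension P?)) i) → Q (element (∁ (comprehension P?)) j)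
        along ε       q = q
        along (e ◅ w) q = along w (closed q (element-∁ _) (element-∁ _) e)

      -- Pairwise separated vertices have different values under `component`, which is therefore
      -- injective on them.
      Separated-≤-c : ∀ {k} (f : Fin k → Fin n) → (∀ i → ¬ P (f i)) →
                      (∀ {i j} → i ≢ j → Separated (f i) (f j)) → k ≤ c (G ─ comprehension P?)
      Separated-≤-c {k} f ∉P sep = injective⇒≤ {f = component ∘ g} inj
        where
        open Components (proj₂ (components (G ─ comprehension P?)))
        g : Fin k → _
        g i = proj₁ (element-∁-surjective (f i) (∉P i))
        g-eq : ∀ i → element (∁ (comprehension P?)) (g i) ≡ f i
        g-eq i = proj₂ (element-∁-surjective (f i) (∉P i))
        inj : ∀ {i j} → component (g i) ≡ component (g j) → i ≡ j
        inj {i} {j} eq with i ≟ j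
        ... | yes i≡j = i≡j
        ... | no  i≢j = contradiction (Equivalence.to same⇔connected eq)
          (Separated⇒¬Connected (subst₂ Separated (sym (g-eq i)) (sym (g-eq j)) (sep i≢j)))

-- Hamiltonian paths

Unique-resp-↭ : ∀ {A : Set} {xs ys : List A} → xs ↭ ys → Unique xs → Unique ys
Unique-resp-↭ {A} = SetoidPermutation.Unique-resp-↭ (setoid A) ∘ ↭⇒↭ₛ

anyList? : ∀ {n} m {P : List (Fin n) → Set} → U.Decidable P → Dec (∃ λ xs → length xs ≤ m × P xs)
anyList? zero    P? = map′ (λ p → [] , z≤n , p) (λ { ([] , _ , p) → p }) (P? [])
anyList? (suc m) P? = map′
  (λ { (inj₁ p) → [] , z≤n , p ; (inj₂ (i , xs , l , p)) → i ∷ xs , s≤s l , p })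
  (λ { ([] , _ , p) → inj₁ p ; (i ∷ xs , s≤s l , p) → inj₂ (i , xs , l , p) })
  (P? [] ⊎-dec any? λ i → anyList? m (λ xs → P? (i ∷ xs)))

Unique-length-≤ : ∀ {n} {xs : List (Fin n)} → Unique xs → length xs ≤ n
Unique-length-≤ {xs = xs} u = injective⇒≤ {f = lookup xs} (lookup-injective u)

-- Lets the main argument proceed by contradiction. The search is finite because a list without
-- repetitions has length at most `n`.
hamiltonian? : ∀ {n} (G : Graph n) → Dec (Hamiltonian G)
hamiltonian? {n} G = map′ to from (anyList? n isCycle?)
  where
  open Graph G
  open DecMembership (_≟_ {n}) using (_∈?_)
  open DecUnique (_≟_ {n}) using (unique?)
  IsCycle : List (Fin n) → Set
  IsCycle []      = ⊥
  IsCycle (s ∷ r) = Linked _~_ (s ∷ r ∷ʳ s) × Unique (s ∷ r) × 3 ≤ length (s ∷ r) × (∀ v → v ∈ s ∷ r)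
  isCycle? : U.Decidable IsCycle
  isCycle? []      = no λ ()
  isCycle? (s ∷ r) = linked? _~?_ _ ×-dec unique? (s ∷ r) ×-dec (3 ≤? length (s ∷ r)) ×-dec all? (_∈? (s ∷ r))
  to : (∃ λ xs → length xs ≤ n × IsCycle xs) → Hamiltonian G
  to (s ∷ r , _ , l , u , ≥3 , cover) =
    record { start = s ; rest = r ; closed = l ; distinct = u ; length≥3 = ≥3 } , cover
  from : Hamiltonian G → ∃ λ xs → length xs ≤ n × IsCycle xs
  from (C , cover) = vertices , Unique-length-≤ distinct , closed , distinct , length≥3 , cover
    where open Cycle C

Spanning : ∀ {n} → List (Fin n) → Set
Spanning L = Unique L × (∀ u → u ∈ L)

Spanning-resp-↭ : ∀ {n} {L M : List (Fin n)} → L ↭ M → Spanning L → Spanning M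
Spanning-resp-↭ σ (u , cover) = Unique-resp-↭ σ u , ∈-resp-↭ σ ∘ cover

Spanning-length : ∀ {n} {L : List (Fin n)} → Spanning L → length L ≡ n
Spanning-length {n} {L} (u , cover) = ≤-antisym (Unique-length-≤ u)
  (injective-into-≤ (λ i → i) (λ eq → eq) L cover)

-- Distinctness is left to `Spanning`, so that pieces can be joined in any order and checked
-- afterwards by permutation.
data Path {n} (G : Graph n) : Fin n → Fin n → List (Fin n) → Set where
  [_] : ∀ p → Path G p p (p ∷ [])
  _∷_ : ∀ {p q r L} → Graph._~_ G p r → Path G r q L → Path G p q (p ∷ L)

module _ {n} {G : Graph n} where
  open Graph G using (_~_)

  first∈ : ∀ {p q L} → Path G p q L → p ∈ L
  first∈ [ _ ]   = here refl
  first∈ (_ ∷ _) = here refl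

  last∈ : ∀ {p q L} → Path G p q L → q ∈ L
  last∈ [ _ ]   = here refl
  last∈ (_ ∷ P) = there (last∈ P)

  _⟨_⟩_ : ∀ {p q r s L M} → Path G p q L → q ~ r → Path G r s M → Path G p s (L ++ M)
  [ _ ]   ⟨ e ⟩ Q = e ∷ Q
  (d ∷ P) ⟨ e ⟩ Q = d ∷ (P ⟨ e ⟩ Q)

  reverse-Path : ∀ {p q L} → Path G p q L → Path G q p (reverse L)
  reverse-Path [ p ] = [ p ]
  reverse-Path (_∷_ {p} {L = L} e P) rewrite List.unfold-reverse p L =
    reverse-Path P ⟨ ~-sym G e ⟩ [ p ]

  -- With at least one edge, the first vertex would recur as the last.
  closed-Path : ∀ {p q L} → Path G p p L → Unique L → q ∈ L → q ≡ p
  closed-Path [ _ ]   _       (here eq) = eq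
  closed-Path (_ ∷ P) (p∉ ∷ _) _ = contradiction refl (All.lookup p∉ (last∈ P))

  Linked⇒Path : ∀ {p s} L → Linked _~_ (p ∷ L ∷ʳ s) → ∃ λ q → Path G p q (p ∷ L) × q ~ s
  Linked⇒Path []      (e ∷ [-]) = _ , [ _ ] , e
  Linked⇒Path (r ∷ L) (e ∷ l) with Linked⇒Path L l
  ... | q , P , d = q , e ∷ P , d

  Path⇒Linked : ∀ {p q s L} → Path G p q L → q ~ s → Linked _~_ (L ∷ʳ s)
  Path⇒Linked [ _ ]             d = d ∷ [-]
  Path⇒Linked (e ∷ P@([ _ ]))   d = e ∷ Path⇒Linked P d
  Path⇒Linked (e ∷ P@(_ ∷ _))   d = e ∷ Path⇒Linked P d

  tour : ∀ {p q L} → Path G p q L → Spanning L → 3 ≤ length L → q ~ p → Hamiltonian G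
  tour {p} {q} {L} P (u , cover) ≥3 e = cycle P u ≥3 (Path⇒Linked P e) cover
    where
    cycle : ∀ {M} → Path G p q M → Unique M → 3 ≤ length M → Linked _~_ (M ∷ʳ p) → (∀ v → v ∈ M) → Hamiltonian G
    cycle [ _ ]   u ≥3 l cover = record { closed = l ; distinct = u ; length≥3 = ≥3 } , cover
    cycle (_ ∷ _) u ≥3 l cover = record { closed = l ; distinct = u ; length≥3 = ≥3 } , cover

Unique-++⁻ : ∀ {A : Set} (xs : List A) {ys} → Unique (xs ++ ys) → Unique xs × Unique ys
Unique-++⁻ []       u       = [] , u
Unique-++⁻ (_ ∷ xs) (p ∷ u) with Unique-++⁻ xs u
... | u₁ , u₂ = All.++⁻ˡ xs p ∷ u₁ , u₂

Unique-disjoint : ∀ {A : Set} {xs ys : List A} {u} → Unique (xs ++ ys) → u ∈ xs → u ∈ ys → ⊥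
Unique-disjoint {xs = _ ∷ xs} (p ∷ _) (here refl) u∈ys = All.lookup p (∈-++⁺ʳ xs u∈ys) refl
Unique-disjoint               (_ ∷ u) (there u∈)  u∈ys = Unique-disjoint u u∈ u∈ys

module _ {n} (G : Graph n) (x y : Fin n) (x≢y : x ≢ y) where
  open Graph G using (_~_)

  private
    G⁺ : Graph n
    G⁺ = addEdge G x y x≢y

    NewEdge : Fin n → Fin n → Set
    NewEdge u v = (u ≡ x × v ≡ y) ⊎ (u ≡ y × v ≡ x)

  Split : Fin n → Fin n → List (Fin n) → Set
  Split p q L = ∃ λ a → ∃ λ b → ∃ λ L₁ → ∃ λ L₂ →
    L ≡ L₁ ++ L₂ × Path G p a L₁ × Path G b q L₂ × NewEdge a b

  ends : ∀ {a b u v} → NewEdge a b → NewEdge u v → u ≡ a ⊎ u ≡ b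
  ends (inj₁ (refl , refl)) (inj₁ (refl , _)) = inj₁ refl
  ends (inj₁ (refl , refl)) (inj₂ (refl , _)) = inj₂ refl
  ends (inj₂ (refl , refl)) (inj₁ (refl , _)) = inj₂ refl
  ends (inj₂ (refl , refl)) (inj₂ (refl , _)) = inj₁ refl

  -- A second use of the new edge would repeat one of its ends, against `Unique`.
  split : ∀ {p q L} → Path G⁺ p q L → Unique L → Path G p q L ⊎ Split p q L
  split [ p ] _ = inj₁ [ p ]
  split {p} (e ∷ P) (p∉ ∷ u) with split P u
  split {p} (inj₁ e ∷ P) (p∉ ∷ u) | inj₁ Q = inj₁ (e ∷ Q)
  split {p} (inj₂ e ∷ P) (p∉ ∷ u) | inj₁ Q = inj₂ (p , _ , _ , _ , refl , [ p ] , Q , e)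
  split {p} (inj₁ e ∷ P) (p∉ ∷ u) | inj₂ (a , b , _ , _ , refl , Q , R , ab) =
    inj₂ (a , b , _ , _ , refl , e ∷ Q , R , ab)
  split {p} (inj₂ e ∷ P) (p∉ ∷ u) | inj₂ (a , b , L₁ , L₂ , refl , Q , R , ab) with ends ab e
  ... | inj₁ refl = contradiction refl (All.lookup p∉ (∈-++⁺ˡ (last∈ Q)))
  ... | inj₂ refl = contradiction refl (All.lookup p∉ (∈-++⁺ʳ L₁ (first∈ R)))

  orient : ∀ {a b L} → NewEdge a b → Path G a b L → Spanning L → ∃ λ M → Path G x y M × Spanning M
  orient (inj₁ (refl , refl)) P s = _ , P , s
  orient {L = L} (inj₂ (refl , refl)) P s =
    _ , reverse-Path P , Spanning-resp-↭ (↭-sym (↭-reverse L)) s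

  NewEdge-sym : ∀ {a b} → NewEdge a b → NewEdge b a
  NewEdge-sym (inj₁ (p , q)) = inj₂ (q , p)
  NewEdge-sym (inj₂ (p , q)) = inj₁ (q , p)

  -- The cycle must use the new edge, and cutting it there gives the path. If the new edge is not
  -- the closing one, the closing edge rejoins the two pieces.
  hamiltonianPath : ¬ Hamiltonian G → Hamiltonian G⁺ → ∃ λ L → Path G x y L × Spanning L
  hamiltonianPath ¬ham (C , cover) with Linked⇒Path (Cycle.rest C) (Cycle.closed C)
  ... | q , P , e with split P (Cycle.distinct C) | e
  ... | inj₁ Q | inj₁ e = contradiction (tour Q (Cycle.distinct C , cover) (Cycle.length≥3 C) e) ¬ham
  ... | inj₁ Q | inj₂ e = orient (NewEdge-sym e) Q (Cycle.distinct C , cover)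
  ... | inj₂ (a , b , L₁ , L₂ , eq , Q , R , ab) | inj₁ e =
    orient (NewEdge-sym ab) (R ⟨ e ⟩ Q)
      (Spanning-resp-↭ (↭-trans (subst (_↭ L₁ ++ L₂) (sym eq) ↭-refl) (++-comm L₁ L₂)) (Cycle.distinct C , cover))
  ... | inj₂ (a , b , L₁ , L₂ , eq , Q , R , ab) | inj₂ e = ⊥-elim (contra (ends ab e) (ends (NewEdge-sym ab) (NewEdge-sym e)))
    where
    start : Fin n
    start = Cycle.start C
    u : Unique (L₁ ++ L₂)
    u = subst Unique eq (Cycle.distinct C)
    -- If an inner edge and the closing edge were both new, the two pieces would share a vertex, or
    -- both would be single vertices, too few for a cycle.
    contra : q ≡ a ⊎ q ≡ b → start ≡ b ⊎ start ≡ a → ⊥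
    contra (inj₁ refl) _           = Unique-disjoint u (last∈ Q) (last∈ R)
    contra (inj₂ refl) (inj₁ refl) = Unique-disjoint u (first∈ Q) (first∈ R)
    contra (inj₂ refl) (inj₂ refl) =
      <-irrefl refl (≤-trans (Cycle.length≥3 C) (Unique-⊆-length {ys = a ∷ b ∷ []} (Cycle.distinct C) two))
      where
      two : ∀ {v} → v ∈ Cycle.vertices C → v ∈ a ∷ b ∷ []
      two v∈ with ∈-++⁻ L₁ (subst (_ ∈_) eq v∈)
      ... | inj₁ v∈₁ = here (closed-Path Q (proj₁ (Unique-++⁻ L₁ u)) v∈₁)
      ... | inj₂ v∈₂ = there (here (closed-Path R (proj₂ (Unique-++⁻ L₁ u)) v∈₂))

-- Rotations of a Hamiltonian path

-- Recursion on `≤‴` raises the lower end, so the list is built from its front.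
segment‴ : ∀ {A : Set} → (ℕ → A) → ∀ {a b} → a ≤‴ b → List A
segment‴ v {a} (≤‴-reflexive _) = v a ∷ []
segment‴ v {a} (≤‴-step p)      = v a ∷ segment‴ v p

-- Opaque so that unification can recover a and b from segment v p.
opaque
  segment : ∀ {A : Set} → (ℕ → A) → ∀ {a b} → a ≤ b → List A
  segment v p = segment‴ v (≤⇒≤‴ p)

segment‴-suc : ∀ {A : Set} (v : ℕ → A) {a b} (p : a ≤‴ b) (q : suc a ≤‴ suc b) →
               segment‴ v q ≡ segment‴ (λ k → v (suc k)) p
segment‴-suc v (≤‴-reflexive _) (≤‴-reflexive _) = refl
segment‴-suc v ≤‴-refl          (≤‴-step q)      = ⊥-elim (<-irrefl refl (≤‴⇒≤ q))
segment‴-suc v (≤‴-step p)      ≤‴-refl          = ⊥-elim (<-irrefl refl (≤‴⇒≤ p))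
segment‴-suc v (≤‴-step p)      (≤‴-step q)      = cong (v (suc _) ∷_) (segment‴-suc v p q)

segment‴-++ : ∀ {A : Set} (v : ℕ → A) {a b c} (p : a ≤‴ b) (q : suc b ≤‴ c) (r : a ≤‴ c) →
              segment‴ v r ≡ segment‴ v p ++ segment‴ v q
segment‴-++ v ≤‴-refl     q ≤‴-refl     = ⊥-elim (<-irrefl refl (≤‴⇒≤ q))
segment‴-++ v ≤‴-refl     q (≤‴-step r) = cong (λ s → v _ ∷ segment‴ v s) (≤‴-irrelevant r q)
segment‴-++ v (≤‴-step p) q ≤‴-refl     = ⊥-elim (<-irrefl refl (≤-trans (≤‴⇒≤ p) (<⇒≤ (≤‴⇒≤ q))))
segment‴-++ v (≤‴-step p) q (≤‴-step r) = cong (v _ ∷_) (segment‴-++ v p q r)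

opaque
  unfolding segment

  segment-++ : ∀ {A : Set} (v : ℕ → A) {a b c} (p : a ≤ b) (q : suc b ≤ c) (r : a ≤ c) →
               segment v r ≡ segment v p ++ segment v q
  segment-++ v p q r = segment‴-++ v (≤⇒≤‴ p) (≤⇒≤‴ q) (≤⇒≤‴ r)

module _ {n} {G : Graph n} where
  open Graph G using (_~_)

  edges : ∀ {p q L} → Path G p q L → ℕ
  edges [ _ ]   = 0
  edges (_ ∷ P) = suc (edges P)

  -- Total on `ℕ`, so that index arithmetic carries no bounds; indices past the end give the last
  -- vertex.
  at : ∀ {p q L} → Path G p q L → ℕ → Fin n
  at [ p ]         _       = p
  at (_∷_ {p} _ _) zero    = p
  at (_ ∷ P)       (suc k) = at P k

  at-first : ∀ {p q L} (P : Path G p q L) → at P 0 ≡ p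
  at-first [ _ ]   = refl
  at-first (_ ∷ _) = refl

  at-last : ∀ {p q L} (P : Path G p q L) → at P (edges P) ≡ q
  at-last [ _ ]   = refl
  at-last (_ ∷ P) = at-last P

  at-step : ∀ {p q L} (P : Path G p q L) {k} → k < edges P → at P k ~ at P (suc k)
  at-step (e ∷ P) {zero}  _       = subst (_ ~_) (sym (at-first P)) e
  at-step (e ∷ P) {suc k} (s≤s l) = at-step P l

  segment‴-at : ∀ {p q L} (P : Path G p q L) (r : 0 ≤‴ edges P) → segment‴ (at P) r ≡ L
  segment‴-at [ _ ]   (≤‴-reflexive _) = refl
  segment‴-at [ _ ]   (≤‴-step r)      with () ← ≤‴⇒≤ r
  segment‴-at (_ ∷ P) (≤‴-step r)      = cong (_ ∷_) (trans (segment‴-suc (at (_ ∷ P)) (≤⇒≤‴ z≤n) r) (segment‴-at P _))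

  opaque
    unfolding segment

    segment-at : ∀ {p q L} (P : Path G p q L) → segment (at P) {0} {edges P} z≤n ≡ L
    segment-at P = segment‴-at P (≤⇒≤‴ z≤n)

module Rotations {n} (G : Graph n) (3≤n : 3 ≤ n) (¬hamiltonian : ¬ Hamiltonian G) (N : ℕ) (v : ℕ → Fin n)
  (v-step : ∀ {k} → k < N → Graph._~_ G (v k) (v (suc k))) (v-spanning : Spanning (segment v {0} {N} z≤n)) where

  open Graph G using (_~_)

  ~s : ∀ {a b} → a ~ b → b ~ a
  ~s = ~-sym G

  x y : Fin n
  x = v 0
  y = v N

  -- A path whose vertices are those of L, in some order.
  Walk : Fin n → Fin n → List (Fin n) → Set
  Walk p q L = ∃ λ M → Path G p q M × M ↭ L

  infixr 5 _·⟨_⟩_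
  _·⟨_⟩_ : ∀ {p q r s L M} → Walk p q L → q ~ r → Walk r s M → Walk p s (L ++ M)
  (_ , P , σ) ·⟨ e ⟩ (_ , Q , τ) = _ , P ⟨ e ⟩ Q , ++⁺ σ τ

  ↑‴ : ∀ {a b} (p : a ≤‴ b) → b ≤ N → Path G (v a) (v b) (segment‴ v p)
  ↑‴ ≤‴-refl     _ = [ _ ]
  ↑‴ (≤‴-step p) l = v-step (≤-trans (≤‴⇒≤ p) l) ∷ ↑‴ p l

  opaque
    unfolding segment

    ↑ : ∀ {a b} (p : a ≤ b) → b ≤ N → Walk (v a) (v b) (segment v p)
    ↑ p l = _ , ↑‴ (≤⇒≤‴ p) l , ↭-refl

    ↓ : ∀ {a b} (p : a ≤ b) → b ≤ N → Walk (v b) (v a) (segment v p)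
    ↓ p l = _ , reverse-Path (↑‴ (≤⇒≤‴ p) l) , ↭-reverse _

  -- The rotations below end here: rejoined in another order, the pieces of the path would form a
  -- Hamiltonian cycle of `G`.
  close : ∀ {p q L M} → Walk p q L → L ↭ M → Spanning M → q ~ p → ⊥
  close (_ , P , σ) τ s e = ¬hamiltonian (tour P s′ (subst (3 ≤_) (sym (Spanning-length s′)) 3≤n) e)
    where s′ = Spanning-resp-↭ (↭-sym (↭-trans σ τ)) s

  prefix : ℕ → List (Fin n)
  prefix a = segment v {0} {a} z≤n

  spanning₂ : ∀ {a} (q : a < N) → Spanning (prefix a ++ segment v q)
  spanning₂ q = subst Spanning (segment-++ v z≤n q z≤n) v-spanning

  spanning₃ : ∀ {a b} (q : a < b) (r : b < N) →
              Spanning (prefix a ++ segment v q ++ segment v r)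
  spanning₃ {a} q r = subst (λ L → Spanning (prefix a ++ L)) (segment-++ v q r a<N) (spanning₂ a<N)
    where a<N = ≤-trans q (<⇒≤ r)

  spanning₄ : ∀ {a b c} (q : a < b) (r : b < c) (s : c < N) →
              Spanning (prefix a ++ segment v q ++ segment v r ++ segment v s)
  spanning₄ {a} q r s = subst (λ L → Spanning (prefix a ++ segment v q ++ L)) (segment-++ v r s b<N) (spanning₃ q b<N)
    where b<N = ≤-trans r (<⇒≤ s)

  -- X and Y label the edge v_k v_{k+1} of the path.
  X Y : ℕ → Set
  X k = x ~ v (suc k)
  Y k = y ~ v k

  -- The cycle would be `v_0 … v_a v_N … v_{a+1} v_0`.
  ¬X∧Y : ∀ {a} → a < N → X a → Y a → ⊥
  ¬X∧Y a<N Xa Ya = close (↑ z≤n (<⇒≤ a<N) ·⟨ ~s Ya ⟩ ↓ a<N ≤-refl) ↭-refl (spanning₂ a<N) (~s Xa)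

  -- For `a < b` the cycle would be `v_0 … v_a v_{b+1} … v_N v_b … v_{a+1} v_0`.
  X-before-Y : ∀ {a b} → a ≤ b → b < N → X a → Y b → ¬ v a ~ v (suc b)
  X-before-Y a≤b b<N Xa Yb e with m≤n⇒m<n∨m≡n a≤b
  ... | inj₁ a<b  = close (↑ z≤n (≤-trans a≤b (<⇒≤ b<N)) ·⟨ e ⟩ ↑ b<N ≤-refl ·⟨ Yb ⟩ ↓ a<b (<⇒≤ b<N))
    (++⁺ˡ (prefix _) (++-comm (segment v b<N) (segment v a<b))) (spanning₃ a<b b<N) (~s Xa)
  ... | inj₂ refl = ¬X∧Y b<N Xa Yb

  -- The cycle would be `v_0 … v_a v_b … v_{a+1} v_N … v_{b+1} v_0`.
  Y⁻-before-X : ∀ {a b} → a < b → b < N → Y (suc a) → X b → ¬ v a ~ v b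
  Y⁻-before-X a<b b<N Ya Xb e =
    close (↑ z≤n (≤-trans (<⇒≤ a<b) (<⇒≤ b<N)) ·⟨ e ⟩ ↓ a<b (<⇒≤ b<N) ·⟨ ~s Ya ⟩ ↓ b<N ≤-refl)
      ↭-refl (spanning₃ a<b b<N) (~s Xb)

  -- The cycle would be `v_0 … v_a v_N … v_{b+1} v_{a+1} … v_b v_0`.
  Y⁺-before-X⁺ : ∀ {a b} → a < b → b < N → Y a → x ~ v b → ¬ v (suc a) ~ v (suc b)
  Y⁺-before-X⁺ a<b b<N Ya xb e =
    close (↑ z≤n (≤-trans (<⇒≤ a<b) (<⇒≤ b<N)) ·⟨ ~s Ya ⟩ ↓ b<N ≤-refl ·⟨ ~s e ⟩ ↑ a<b (<⇒≤ b<N))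
      (++⁺ˡ (prefix _) (++-comm (segment v b<N) (segment v a<b))) (spanning₃ a<b b<N) (~s xb)

  -- Cutting after `v_a`, `v_b` and `v_c` leaves four segments, the first being `prefix a`. The
  -- subscripts of a tour list them in the order of visit; a `Walk` argument leaves the direction of
  -- its segment open.
  module Four {a b c} (a<b : a < b) (b<c : b < c) (c<N : c < N) where

    S₂ S₃ S₄ : List (Fin n)
    S₂ = segment v a<b
    S₃ = segment v b<c
    S₄ = segment v c<N

    b≤N : b ≤ N
    b≤N = ≤-trans (<⇒≤ b<c) (<⇒≤ c<N)

    a≤N : a ≤ N
    a≤N = ≤-trans (<⇒≤ a<b) b≤N

    tour₁₄₂₃ : ∀ {p q r s} → Y a → v (suc c) ~ p → Walk p q S₂ → q ~ r → Walk r s S₃ → s ~ x → ⊥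
    tour₁₄₂₃ Ya d W e W′ = close (↑ z≤n a≤N ·⟨ ~s Ya ⟩ ↓ c<N ≤-refl ·⟨ d ⟩ W ·⟨ e ⟩ W′)
      (++⁺ˡ (prefix a) (↭-trans (++-comm S₄ (S₂ ++ S₃)) (↭-reflexive (List.++-assoc S₂ S₃ S₄)))) (spanning₄ a<b b<c c<N)

    tour₁₃₂₄ : ∀ {p q} → Y b → X c → v a ~ p → Walk p q S₃ → q ~ v (suc a) → ⊥
    tour₁₃₂₄ Yb Xc d W e = close (↑ z≤n a≤N ·⟨ d ⟩ W ·⟨ e ⟩ ↑ a<b b≤N ·⟨ ~s Yb ⟩ ↓ c<N ≤-refl)
      (++⁺ˡ (prefix a) (shifts S₃ S₂)) (spanning₄ a<b b<c c<N) (~s Xc)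

    tour₁₃₄₂ : X a → Y b → v a ~ v c → v (suc b) ~ v (suc c) → ⊥
    tour₁₃₄₂ Xa Yb d e = close (↑ z≤n a≤N ·⟨ d ⟩ ↓ b<c (<⇒≤ c<N) ·⟨ e ⟩ ↑ c<N ≤-refl ·⟨ Yb ⟩ ↓ a<b b≤N)
      (++⁺ˡ (prefix a) (↭-trans (↭-reflexive (sym (List.++-assoc S₃ S₄ S₂))) (++-comm (S₃ ++ S₄) S₂)))
      (spanning₄ a<b b<c c<N) (~s Xa)

  -- The labels give the cycle `v_0 … v_a v_N … v_{b+1} v_0`, which misses only `v_{a+1} … v_b`. The
  -- two chords would insert this segment between `v_k` and `v_{k+1}`. The next three lemmas vary
  -- its direction and the place of `k`.
  insert-after : ∀ {a b k} → a < b → b < k → k < N → Y a → X b → v (suc a) ~ v k → ¬ v b ~ v (suc k)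
  insert-after a<b b<k k<N Ya Xb d e =
    tour₁₄₂₃ Ya (~s e) (↓ a<b b≤N) d (↓ b<k (<⇒≤ k<N)) (~s Xb)
    where open Four a<b b<k k<N

  insert-after′ : ∀ {a b k} → a < b → b < k → k < N → Y a → X b → v (suc a) ~ v (suc k) → ¬ v b ~ v k
  insert-after′ a<b b<k k<N Ya Xb d e =
    tour₁₄₂₃ Ya (~s d) (↑ a<b b≤N) e (↓ b<k (<⇒≤ k<N)) (~s Xb)
    where open Four a<b b<k k<N

  insert-before : ∀ {k a b} → k < a → a < b → b < N → Y a → X b → v k ~ v (suc a) → ¬ v (suc k) ~ v b
  insert-before k<a a<b b<N Ya Xb d e = tour₁₃₂₄ Ya Xb d (↑ a<b (<⇒≤ b<N)) (~s e)
    where open Four k<a a<b b<N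

  insert-before′ : ∀ {k a b} → k < a → a < b → b < N → Y a → X b → v k ~ v b → ¬ v (suc k) ~ v (suc a)
  insert-before′ k<a a<b b<N Ya Xb d e = tour₁₃₂₄ Ya Xb d (↓ a<b (<⇒≤ b<N)) (~s e)
    where open Four k<a a<b b<N

-- Separation by isolation, and the indices of a segment

module _ {n} {P : Fin n → Set} {P? : U.Decidable P} {G : Graph n} where
  open Graph G using (_~_)

  Separated-sym : ∀ {u w} → Separated P? G u w → Separated P? G w u
  Separated-sym (separatedBy Q q ¬q closed) = separatedBy (λ a → ¬ Q a) ¬q (λ ¬q → ¬q q)
    λ ¬Qa ∉a ∉b e Qb → ¬Qa (closed Qb ∉b ∉a (~-sym G e))

  isolated⇒Separated : ∀ {u w} → (∀ {a} → u ~ a → P a) → u ≢ w → Separated P? G u w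
  isolated⇒Separated nbr u≢w = separatedBy (_≡ _) refl (u≢w ∘ sym) λ { refl _ ∉b e → contradiction (nbr e) ∉b }

∈-segment‴⁻ : ∀ {A : Set} (v : ℕ → A) {a b} (p : a ≤‴ b) {u} → u ∈ segment‴ v p → ∃ λ k → k ≤ b × v k ≡ u
∈-segment‴⁻ v ≤‴-refl     (here refl) = _ , ≤-refl , refl
∈-segment‴⁻ v (≤‴-step p) (here refl) = _ , <⇒≤ (≤‴⇒≤ p) , refl
∈-segment‴⁻ v (≤‴-step p) (there u∈)  = ∈-segment‴⁻ v p u∈

last∈-segment‴ : ∀ {A : Set} (v : ℕ → A) {a b} (p : a ≤‴ b) → v b ∈ segment‴ v p
last∈-segment‴ v ≤‴-refl     = here refl
last∈-segment‴ v (≤‴-step p) = there (last∈-segment‴ v p)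

opaque
  unfolding segment

  ∈-segment⁻ : ∀ {A : Set} (v : ℕ → A) {a b} (p : a ≤ b) {u} → u ∈ segment v p → ∃ λ k → k ≤ b × v k ≡ u
  ∈-segment⁻ v p = ∈-segment‴⁻ v (≤⇒≤‴ p)

  ∈-segment⁺ : ∀ {A : Set} (v : ℕ → A) {a b k} (p : a ≤ b) → a ≤ k → k ≤ b → v k ∈ segment v p
  ∈-segment⁺ v p a≤k k≤b with m≤n⇒m<n∨m≡n k≤b
  ... | inj₁ k<b = subst (v _ ∈_) (sym (segment-++ v a≤k k<b p)) (∈-++⁺ˡ (last∈-segment‴ v (≤⇒≤‴ a≤k)))
  ... | inj₂ refl = last∈-segment‴ v (≤⇒≤‴ p)

-- Toughness against the labels of the path

bit : ∀ {P : Set} → Dec P → ℕ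
bit P? = if does P? then 1 else 0

bit-≤1 : ∀ {P : Set} (P? : Dec P) → bit P? ≤ 1
bit-≤1 (yes _) = ≤-refl
bit-≤1 (no  _) = z≤n

length-filter-∷ : ∀ {A : Set} {P : A → Set} (P? : U.Decidable P) x xs →
                  length (filter P? (x ∷ xs)) ≡ bit (P? x) + length (filter P? xs)
length-filter-∷ P? x xs with does (P? x)
... | true  = refl
... | false = refl

-- The inequality that toughness would give for `2 + r` D-vertices and the set of their neighbours.
many-components-≰ : ∀ T o r → 3 ≤ T → o < T → ¬ T * (3 + r) ≤ (2 + r) + ((2 + r) + (o + o))
many-components-≰ T o r 3≤T o<T le = <-irrefl refl (begin-strict
  (2 + r) + ((2 + r) + (o + o)) ≡⟨ lhs o r ⟩
  (suc o + suc o) + 2 * suc r   <⟨ +-mono-≤-< (+-mono-≤ o<T o<T) (*-monoˡ-< (suc r) 3≤T) ⟩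
  (T + T) + T * suc r           ≡⟨ rhs T r ⟩
  T * (3 + r)                   ≤⟨ le ⟩
  (2 + r) + ((2 + r) + (o + o)) ∎)
  where
  open ≤-Reasoning
  lhs : ∀ o r → (2 + r) + ((2 + r) + (o + o)) ≡ (suc o + suc o) + 2 * suc r
  lhs = solve-∀
  rhs : ∀ T r → (T + T) + T * suc r ≡ T * (3 + r)
  rhs = solve-∀

-- With `suc M` edges, the inner vertices of the path are the `v_{a+1}` with `a < M`.
module Counting {n} (G : Graph n) (3≤n : 3 ≤ n) (¬hamiltonian : ¬ Hamiltonian G) (M : ℕ) (v : ℕ → Fin n)
  (v-step : ∀ {k} → k < suc M → Graph._~_ G (v k) (v (suc k)))
  (v-spanning : Spanning (segment v {0} {suc M} z≤n))
  (T : ℕ) (3≤T : 3 ≤ T)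
  (tough : ∀ S k → 2 ≤ k → k ≤ c (G ─ S) → T * k ≤ ∣ S ∣)
  (n≤deg+T : n ≤ deg G (v 0) + deg G (v (suc M)) + T) where

  open Graph G using (_~_; _~?_)

  N : ℕ
  N = suc M

  open Rotations G 3≤n ¬hamiltonian N v v-step v-spanning

  -- Positions on the path and the number of labels

  v⁺ v⁺⁺ : ℕ → Fin n
  v⁺  k = v (suc k)
  v⁺⁺ k = v (suc (suc k))

  ~-irr : ∀ {u} → ¬ u ~ u
  ~-irr = ~-irrefl G refl

  v-< : ∀ {k l} → k < l → l ≤ N → v k ≢ v l
  v-< k<l l≤N eq = Unique-disjoint
    (subst Unique (segment-++ v z≤n (≤-trans k<l l≤N) z≤n) (proj₁ v-spanning))
    (∈-segment⁺ v z≤n z≤n ≤-refl)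
    (subst (_∈ segment v (≤-trans k<l l≤N)) (sym eq) (∈-segment⁺ v (≤-trans k<l l≤N) k<l l≤N))

  v-injective : ∀ {k l} → k ≤ N → l ≤ N → v k ≡ v l → k ≡ l
  v-injective {k} {l} k≤N l≤N eq with <-cmp k l
  ... | tri< k<l _ _ = contradiction eq (v-< k<l l≤N)
  ... | tri≈ _ k≡l _ = k≡l
  ... | tri> _ _ l<k = contradiction (sym eq) (v-< l<k k≤N)

  position : ∀ u → ∃ λ k → k ≤ N × v k ≡ u
  position u = ∈-segment⁻ v z≤n (proj₂ v-spanning u)

  suc-N≤n : suc N ≤ n
  suc-N≤n = injective⇒≤ {f = v ∘ toℕ} λ {i} {j} eq →
    toℕ-injective (v-injective (s≤s⁻¹ (toℕ<n i)) (s≤s⁻¹ (toℕ<n j)) eq)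

  X? : U.Decidable X
  X? k = x ~? v (suc k)

  Y? : U.Decidable Y
  Y? k = y ~? v k

  -- D a says that the edge before the vertex v_{a+1} is labelled Y and the edge after it X.
  O D : ℕ → Set
  O k = ¬ X k × ¬ Y k
  D a = Y a × X (suc a)

  O? : U.Decidable O
  O? k = ¬? (X? k) ×-dec ¬? (Y? k)

  D? : U.Decidable D
  D? a = Y? a ×-dec X? (suc a)

  Os Ds : List ℕ
  Os = filter O? (downFrom N)
  Ds = filter D? (downFrom M)

  ∈-Os : ∀ {k} → k < N → ¬ X k → ¬ Y k → k ∈ Os
  ∈-Os k<N ¬Xk ¬Yk = ∈-filter⁺ O? (∈-downFrom⁺ k<N) (¬Xk , ¬Yk)

  ∈-Ds : ∀ {a} → a < M → D a → a ∈ Ds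
  ∈-Ds a<M = ∈-filter⁺ D? (∈-downFrom⁺ a<M)

  count-XYO : ∀ m → m ≤ N → length (filter X? (downFrom m)) + length (filter Y? (downFrom m))
                            + length (filter O? (downFrom m)) ≤ m
  count-XYO zero    _   = z≤n
  count-XYO (suc m) m<N with X? m | Y? m | count-XYO m (<⇒≤ m<N)
  ... | yes Xm | yes Ym | _  = ⊥-elim (¬X∧Y m<N Xm Ym)
  ... | yes _  | no _   | ih = s≤s ih
  ... | no _   | yes _  | ih = subst (_≤ suc m) (sym (cong (_+ length (filter O? (downFrom m))) (+-suc _ _))) (s≤s ih)
  ... | no _   | no _   | ih = subst (_≤ suc m) (sym (+-suc _ _)) (s≤s ih)

  -- A neighbour of `v_0` is some `v_{k+1}`, and then the edge `v_k v_{k+1}` is labelled X.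
  deg-x : deg G x ≤ length (filter X? (downFrom N))
  deg-x = subst (deg G x ≤_) (List.length-map v⁺ (filter X? (downFrom N)))
    (Unique-⊆-length {xs = filter (x ~?_) (allFin n)} (Unique.filter⁺ (x ~?_) (Unique.allFin⁺ n)) sub)
    where
    sub : ∀ {u} → u ∈ filter (x ~?_) (allFin n) → u ∈ map v⁺ (filter X? (downFrom N))
    sub {u} u∈ with position u | proj₂ (∈-filter⁻ (x ~?_) {xs = allFin n} u∈)
    ... | zero  , _   , refl | e = contradiction e ~-irr
    ... | suc k , k<N , refl | e = ∈-map⁺ v⁺ (∈-filter⁺ X? (∈-downFrom⁺ k<N) e)

  deg-y : deg G y ≤ length (filter Y? (downFrom N))
  deg-y = subst (deg G y ≤_) (List.length-map v (filter Y? (downFrom N)))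
    (Unique-⊆-length {xs = filter (y ~?_) (allFin n)} (Unique.filter⁺ (y ~?_) (Unique.allFin⁺ n)) sub)
    where
    sub : ∀ {u} → u ∈ filter (y ~?_) (allFin n) → u ∈ map v (filter Y? (downFrom N))
    sub {u} u∈ with position u | proj₂ (∈-filter⁻ (y ~?_) {xs = allFin n} u∈)
    ... | k , k≤N , refl | e with m≤n⇒m<n∨m≡n k≤N
    ... | inj₁ k<N  = ∈-map⁺ v (∈-filter⁺ Y? (∈-downFrom⁺ k<N) e)
    ... | inj₂ refl = contradiction e ~-irr

  o : ℕ
  o = length Os

  -- The labels X and Y are at least as many as the two degrees, so the degrees and `o` together are
  -- at most `N`, which is below `n`.
  o<T : o < T
  o<T = +-cancelˡ-≤ (deg G x + deg G y) (suc o) T (begin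
    deg G x + deg G y + suc o                                                   ≡⟨ +-suc _ o ⟩
    suc (deg G x + deg G y + o)                                                 ≤⟨ s≤s (+-monoˡ-≤ o (+-mono-≤ deg-x deg-y)) ⟩
    suc (length (filter X? (downFrom N)) + length (filter Y? (downFrom N)) + o) ≤⟨ s≤s (count-XYO N ≤-refl) ⟩
    suc N                                                                       ≤⟨ suc-N≤n ⟩
    n                                                                           ≤⟨ n≤deg+T ⟩
    deg G x + deg G y + T                                                       ∎)
    where open ≤-Reasoning

  -- The contradiction used twice below: `2 o + 1` vertices are too few to leave two components.
  1+o+o≱ : ¬ T * 2 ≤ suc (o + o)
  1+o+o≱ le = <-irrefl refl (begin-strict
    suc (o + o)   <⟨ s≤s (≤-reflexive (sym (+-suc o o))) ⟩
    suc o + suc o ≤⟨ +-mono-≤ o<T o<T ⟩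
    T + T         ≡⟨ cong (T +_) (sym (+-identityʳ T)) ⟩
    2 * T         ≡⟨ *-comm 2 T ⟩
    T * 2         ≤⟨ le ⟩
    suc (o + o)   ∎)
    where open ≤-Reasoning

  -- Neighbours of the D-vertices

  Nbr : Fin n → Set
  Nbr u = ∃ λ a → a < M × D a × v (suc a) ~ u

  Nbr? : U.Decidable Nbr
  Nbr? u = anyUpTo? (λ a → D? a ×-dec (v (suc a) ~? u)) M

  Later Earlier : ℕ → Set
  Later   j = ∃ λ a → a < M × D a × suc a < j × v (suc a) ~ v j
  Earlier j = ∃ λ a → a < M × D a × j < suc a × v (suc a) ~ v j

  Later? : U.Decidable Later
  Later? j = anyUpTo? (λ a → D? a ×-dec (suc a <? j) ×-dec (v (suc a) ~? v j)) M

  Earlier? : U.Decidable Earlier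
  Earlier? j = anyUpTo? (λ a → D? a ×-dec (j <? suc a) ×-dec (v (suc a) ~? v j)) M

  -- By no-consecutive-later, an unlabelled edge v_k v_{k+1} accounts for only one of v_{k+1}, v_{k+2}
  -- among the later neighbours of D-vertices; φ picks it out, and ψ does the same for v_{k-1}, v_k
  -- among the earlier neighbours.
  φ ψ : ℕ → Fin n
  φ k with Later? (suc k)
  ... | yes _ = v (suc k)
  ... | no  _ = v (suc (suc k))
  ψ k with Earlier? k
  ... | yes _ = v k
  ... | no  _ = v (pred k)

  -- The segment from one D-vertex to the other would be inserted between `v_k` and `v_{k+1}`; their
  -- order decides its direction.
  no-consecutive-later : ∀ {a a′ k} → suc a < k → suc a′ < k → k < N → D a → D a′ →
                         v (suc a) ~ v k → ¬ v (suc a′) ~ v (suc k)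
  no-consecutive-later {a} {a′} a<k a′<k k<N (Ya , Xa) (Ya′ , Xa′) e e′ with ≤-total a a′
  ... | inj₁ a≤a′ = insert-after  (s≤s a≤a′) a′<k k<N Ya  Xa′ e e′
  ... | inj₂ a′≤a = insert-after′ (s≤s a′≤a) a<k  k<N Ya′ Xa  e′ e

  no-consecutive-earlier : ∀ {a a′ k} → k < a → k < a′ → a < M → a′ < M → D a → D a′ →
                           v (suc a) ~ v k → ¬ v (suc a′) ~ v (suc k)
  no-consecutive-earlier {a} {a′} k<a k<a′ a<M a′<M (Ya , Xa) (Ya′ , Xa′) e e′ with ≤-total a a′
  ... | inj₁ a≤a′ = insert-before  k<a  (s≤s a≤a′) (s≤s a′<M) Ya  Xa′ (~s e) (~s e′)
  ... | inj₂ a′≤a = insert-before′ k<a′ (s≤s a′≤a) (s≤s a<M)  Ya′ Xa  (~s e) (~s e′)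

  -- Write edge `k` for `v_k v_{k+1}` and let `j` be `l + 2`. Edge `l + 1` is not labelled Y. If it
  -- is labelled X, then edge `l` is not labelled X, so either edge `l` is labelled Y and `v_{l+1}`
  -- is a D-vertex, or edge `l` is unlabelled. The last component places the unlabelled edge after a
  -- D-vertex, for use when there is only one.
  later : ∀ {j} → j ≤ N → Later j →
          v j ∈ map v⁺⁺ Ds ⊎ ∃ λ k → k ∈ Os × v j ≡ φ k × ∃ λ a → a < M × D a × a < k
  later {suc (suc l)} l<N L@(a , a<M , Da@(Ya , Xa) , s≤s a<l , e) with X? (suc l)
  ... | no ¬Xl = inj₂ (suc l , ∈-Os l<N ¬Xl ¬Yl , eq , a , a<M , Da , a<l)
    where
    ¬Yl : ¬ Y (suc l)
    ¬Yl Yl = X-before-Y a<l l<N Xa Yl e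
    eq : v (suc (suc l)) ≡ φ (suc l)
    eq with Later? (suc (suc l))
    ... | yes _ = refl
    ... | no ¬L = contradiction L ¬L
  ... | yes Xl with Y? l
  ... | yes Yl = inj₁ (∈-map⁺ v⁺⁺ (∈-Ds (s≤s⁻¹ l<N) (Yl , Xl)))
  ... | no ¬Yl = inj₂ (l , ∈-Os (<⇒≤ l<N) ¬Xl ¬Yl , eq , a , a<M , Da , a<l′)
    where
    ¬Xl : ¬ X l
    ¬Xl xl = Y⁺-before-X⁺ a<l l<N Ya xl e
    a<l′ : a < l
    a<l′ = ≤∧≢⇒< (s≤s⁻¹ a<l) λ { refl → ¬Yl Ya }
    eq : v (suc (suc l)) ≡ φ l
    eq with Later? (suc l)
    ... | yes (a′ , _ , Da′ , a′<l , e′) = ⊥-elim (no-consecutive-later a′<l (s≤s a<l′) l<N Da′ Da e′ e)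
    ... | no _ = refl
  later {suc zero} _ (_ , _ , _ , s≤s () , _)

  -- Mirrors `later`, with the edges `j` and `j + 1` that follow `v_j`.
  earlier : ∀ {j} → Earlier j →
            v j ∈ map v Ds ⊎ ∃ λ k → k ∈ Os × v j ≡ ψ k × ∃ λ a → a < M × D a × k ≤ a
  earlier {j} E@(a , a<M , Da@(Ya , Xa) , s≤s j≤a , e) with Y? j
  ... | no ¬Yj = inj₂ (j , ∈-Os (s≤s (≤-trans j≤a (<⇒≤ a<M))) ¬Xj ¬Yj , eq , a , a<M , Da , j≤a)
    where
    ¬Xj : ¬ X j
    ¬Xj Xj = X-before-Y j≤a (s≤s (<⇒≤ a<M)) Xj Ya (~s e)
    eq : v j ≡ ψ j
    eq with Earlier? j
    ... | yes _ = refl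
    ... | no ¬E = contradiction E ¬E
  ... | yes Yj with X? (suc j)
  ... | yes Xj = inj₁ (∈-map⁺ v (∈-Ds (≤-trans (s≤s j≤a) a<M) (Yj , Xj)))
  ... | no ¬Xj = inj₂ (suc j , ∈-Os (s≤s (≤-trans (s≤s j≤a) a<M)) ¬Xj ¬Yj , eq , a , a<M , Da , j<a)
    where
    ¬Yj : ¬ Y (suc j)
    ¬Yj Yj = Y⁻-before-X (s≤s j≤a) (s≤s a<M) Yj Xa (~s e)
    j<a : j < a
    j<a = ≤∧≢⇒< j≤a λ { refl → ¬Xj Xa }
    eq : v j ≡ ψ (suc j)
    eq with Earlier? (suc j)
    ... | yes (a′ , a′<M , Da′ , s≤s j<a′ , e′) = ⊥-elim (no-consecutive-earlier j<a j<a′ a<M a′<M Da Da′ e e′)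
    ... | no _ = refl

  Nbr⇒ : ∀ {u} → Nbr u → ∃ λ j → j ≤ N × v j ≡ u × (Later j ⊎ Earlier j)
  Nbr⇒ {u} (a , a<M , Da , e) with position u
  ... | j , j≤N , refl with <-cmp (suc a) j
  ... | tri< a<j _ _  = j , j≤N , refl , inj₁ (a , a<M , Da , a<j , e)
  ... | tri≈ _ refl _ = contradiction e ~-irr
  ... | tri> _ _ j<a  = j , j≤N , refl , inj₂ (a , a<M , Da , j<a , e)

  -- Each D-vertex contributes the two vertices beside it, each unlabelled edge at most one later
  -- and one earlier neighbour.
  ∣Nbr∣-≤ : ∣ comprehension Nbr? ∣ ≤ length Ds + (length Ds + (o + o))
  ∣Nbr∣-≤ = subst (∣ comprehension Nbr? ∣ ≤_) len (∣comprehension∣-≤ Nbr? bound sub)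
    where
    bound : List (Fin n)
    bound = map v⁺⁺ Ds ++ map v Ds ++ map φ Os ++ map ψ Os
    len : length bound ≡ length Ds + (length Ds + (o + o))
    len = trans (List.length-++ (map v⁺⁺ Ds)) (cong₂ _+_ (List.length-map _ Ds)
         (trans (List.length-++ (map v Ds)) (cong₂ _+_ (List.length-map _ Ds)
         (trans (List.length-++ (map φ Os)) (cong₂ _+_ (List.length-map _ Os) (List.length-map _ Os))))))
    sub : ∀ u → Nbr u → u ∈ bound
    sub u nb with Nbr⇒ nb
    ... | j , j≤N , refl , inj₁ L with later j≤N L
    ... | inj₁ j∈ = ∈-++⁺ˡ j∈
    ... | inj₂ (k , k∈ , eq , _) = ∈-++⁺ʳ (map v⁺⁺ Ds) (∈-++⁺ʳ (map v Ds)
      (∈-++⁺ˡ (subst (_∈ map φ Os) (sym eq) (∈-map⁺ φ k∈))))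
    sub u nb | j , j≤N , refl , inj₂ E with earlier E
    ... | inj₁ j∈ = ∈-++⁺ʳ (map v⁺⁺ Ds) (∈-++⁺ˡ j∈)
    ... | inj₂ (k , k∈ , eq , _) = ∈-++⁺ʳ (map v⁺⁺ Ds) (∈-++⁺ʳ (map v Ds)
      (∈-++⁺ʳ (map φ Os) (subst (_∈ map ψ Os) (sym eq) (∈-map⁺ ψ k∈))))

  -- An unlabelled edge lies on one side of the only D-vertex, so it accounts for a later or an
  -- earlier neighbour but not for both; `χ` chooses by side.
  ∣Nbr∣-≤-single : ∀ {d} → Ds ≡ d ∷ [] → ∣ comprehension Nbr? ∣ ≤ 2 + o
  ∣Nbr∣-≤-single {d} Ds≡ = subst (∣ comprehension Nbr? ∣ ≤_) (cong (2 +_) (List.length-map χ Os)) (∣comprehension∣-≤ Nbr? bound sub)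
    where
    χ : ℕ → Fin n
    χ k with k ≤? d
    ... | yes _ = ψ k
    ... | no  _ = φ k
    χ-ψ : ∀ {k} → k ≤ d → χ k ≡ ψ k
    χ-ψ {k} k≤d with k ≤? d
    ... | yes _  = refl
    ... | no k≰d = contradiction k≤d k≰d
    χ-φ : ∀ {k} → d < k → χ k ≡ φ k
    χ-φ {k} d<k with k ≤? d
    ... | yes k≤d = contradiction k≤d (<⇒≱ d<k)
    ... | no _    = refl
    bound : List (Fin n)
    bound = v (suc (suc d)) ∷ v d ∷ map χ Os
    only : ∀ {a} → a < M → D a → a ≡ d
    only a<M Da with subst (_ ∈_) Ds≡ (∈-Ds a<M Da)
    ... | here a≡d = a≡d
    sub : ∀ u → Nbr u → u ∈ bound
    sub u nb with Nbr⇒ nb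
    ... | j , j≤N , refl , inj₁ L with later j≤N L
    ... | inj₁ j∈ with subst (λ ds → _ ∈ map v⁺⁺ ds) Ds≡ j∈
    ... | here eq = here eq
    sub u nb | j , j≤N , refl , inj₁ L | inj₂ (k , k∈ , eq , a , a<M , Da , a<k) with only a<M Da
    ... | refl = there (there (subst (_∈ map χ Os) (trans (χ-φ a<k) (sym eq)) (∈-map⁺ χ k∈)))
    sub u nb | j , j≤N , refl , inj₂ E with earlier E
    ... | inj₁ j∈ with subst (λ ds → _ ∈ map v ds) Ds≡ j∈
    ... | here eq = there (here eq)
    sub u nb | j , j≤N , refl , inj₂ E | inj₂ (k , k∈ , eq , a , a<M , Da , k≤a) with only a<M Da
    ... | refl = there (there (subst (_∈ map χ Os) (trans (χ-ψ k≤a) (sym eq)) (∈-map⁺ χ k∈)))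

  Ds-< : ∀ {a} → a ∈ Ds → a < M × D a
  Ds-< a∈ with ∈-filter⁻ D? {xs = downFrom M} a∈
  ... | a∈′ , Da = ∈-downFrom⁻ a∈′ , Da

  ¬D~D : ∀ {a b} → a < M → b < M → D a → D b → ¬ v (suc a) ~ v (suc b)
  ¬D~D {a} {b} a<M b<M (_ , Xa) (Yb , Xb) e with <-cmp a b
  ... | tri< a<b _ _  = X-before-Y a<b (s≤s (<⇒≤ b<M)) Xa Yb e
  ... | tri≈ _ refl _ = ~-irr e
  ¬D~D {a} {b} a<M b<M (Ya , _) (_ , Xb) e | tri> _ _ b<a = X-before-Y b<a (s≤s (<⇒≤ a<M)) Xb Ya (~s e)

  -- Deleting the neighbours isolates every D-vertex. `x` survives in a further component, since
  -- `x ~ v (suc a)` would give edge `a` both labels.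
  Ds-tough : ∀ {d ds} → Ds ≡ d ∷ ds → T * suc (length Ds) ≤ ∣ comprehension Nbr? ∣
  Ds-tough Ds≡ = tough (comprehension Nbr?) _ (s≤s (subst (λ L → 1 ≤ length L) (sym Ds≡) (s≤s z≤n))) (Separated-≤-c Nbr? G f f∉ f-sep)
    where
    f : Fin (suc (length Ds)) → Fin n
    f zero    = x
    f (suc i) = v (suc (lookup Ds i))
    f∉ : ∀ i → ¬ Nbr (f i)
    f∉ zero    (suc a , a<M , (Ya , Xa) , e) = ¬X∧Y (<⇒≤ (s≤s a<M)) (~s e) Ya
    f∉ zero    (zero  , a<M , (Ya , Xa) , e) = ¬X∧Y (s≤s z≤n) (~s e) Ya
    f∉ (suc i) (a , a<M , Da , e) with Ds-< (∈-lookup {xs = Ds} i)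
    ... | b<M , Db = ¬D~D a<M b<M Da Db e
    isolated : ∀ i {w} → v (suc (lookup Ds i)) ≢ w → Separated Nbr? G (v (suc (lookup Ds i))) w
    isolated i with Ds-< (∈-lookup {xs = Ds} i)
    ... | b<M , Db = isolated⇒Separated {P? = Nbr?} λ e → _ , b<M , Db , e
    bounded : ∀ i → suc (lookup Ds i) ≤ N
    bounded i = s≤s (<⇒≤ (proj₁ (Ds-< (∈-lookup {xs = Ds} i))))
    f-sep : ∀ {i j} → i ≢ j → Separated Nbr? G (f i) (f j)
    f-sep {zero}  {zero}  i≢j = contradiction refl i≢j
    f-sep {zero}  {suc j} _   = Separated-sym {P? = Nbr?} (isolated j (v-< (s≤s z≤n) (bounded j) ∘ sym))
    f-sep {suc i} {zero}  _   = isolated i (v-< (s≤s z≤n) (bounded i) ∘ sym)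
    f-sep {suc i} {suc j} i≢j = isolated i λ eq → i≢j (cong suc
      (lookup-injective (Unique.filter⁺ D? (Unique.downFrom⁺ M)) (suc-injective (v-injective (bounded i) (bounded j) eq))))

  -- For one D-vertex the general bound `2 + 2 o` would not contradict `2 T`, hence the sharper
  -- `∣Nbr∣-≤-single`.
  Ds≡[] : Ds ≡ []
  Ds≡[] with Ds in eq
  ... | []         = refl
  ... | d ∷ []     = ⊥-elim (<-irrefl refl (begin-strict
    2 + o                  <⟨ +-mono-≤ 3≤T (<⇒≤ o<T) ⟩
    T + T                  ≡⟨ cong (T +_) (sym (+-identityʳ T)) ⟩
    2 * T                  ≡⟨ *-comm 2 T ⟩
    T * 2                  ≡⟨ cong (λ L → T * suc (length L)) (sym eq) ⟩
    T * suc (length Ds)    ≤⟨ Ds-tough {d} {[]} eq ⟩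
    ∣ comprehension Nbr? ∣ ≤⟨ ∣Nbr∣-≤-single eq ⟩
    2 + o                  ∎))
    where open ≤-Reasoning
  ... | d ∷ e ∷ ds = ⊥-elim (many-components-≰ T o (length ds) 3≤T o<T
    (subst (λ L → T * suc (length L) ≤ length L + (length L + (o + o))) eq
      (≤-trans (Ds-tough {d} {e ∷ ds} eq) ∣Nbr∣-≤)))

  ¬D : ∀ {a} → a < M → ¬ D a
  ¬D a<M Da with subst (_ ∈_) Ds≡[] (∈-Ds a<M Da)
  ... | ()

  -- v_0 … v_b v_N … v_{g+1} v_{b+1} … v_g is a Hamiltonian path from x to v_g; if moreover X g, there
  -- is also one from v_g to y, and the restrictions from both ends leave v_g too few neighbours.
  module CrossEdge {b g} (b<g : b < g) (g<N : g < N) (Yb : Y b) (cross : v (suc b) ~ v (suc g)) where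

    -- With `¬X⁺-after`, this is the argument of `¬X∧Y` for the rotated path ending in `v_g`: there
    -- `v_{i+1}` follows `v_i` for `i < g` other than `b`, and `v_k` follows `v_{k+1}` for `k > g`.
    -- At `i = b` the original edge would have both labels.
    ¬X-before : ∀ {i} → i < g → X i → ¬ v i ~ v g
    ¬X-before {i} i<g Xi e with <-cmp i b
    ... | tri< i<b _ _  = Four.tour₁₃₄₂ i<b b<g g<N Xi Yb e cross
    ... | tri≈ _ refl _ = ¬X∧Y (<-trans i<g g<N) Xi Yb
    ... | tri> _ _ b<i  = insert-after′ b<i i<g g<N Yb Xi cross e

    ¬X⁺-after : ∀ {k} → g < k → k < N → x ~ v k → ¬ v g ~ v (suc k)
    ¬X⁺-after g<k k<N xk e =
      Four.tour₁₄₂₃ b<g g<k k<N Yb (~s e) (↓ b<g (<⇒≤ g<N)) cross (↑ g<k (<⇒≤ k<N)) (~s xk)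

    -- Otherwise the path edge entering `v_g` is labelled X and contradicts `¬X-before`.
    x≁v : ¬ x ~ v g
    x≁v = go b<g g<N ¬X-before
      where
      go : ∀ {g} → b < g → g < N → (∀ {i} → i < g → X i → ¬ v i ~ v g) → ¬ x ~ v g
      go {suc g} _ g<N ¬X e = ¬X ≤-refl e (v-step (<⇒≤ g<N))

    module _ (Xg : X g) where

      NbrOf : Fin n → Set
      NbrOf u = v g ~ u

      NbrOf? : U.Decidable NbrOf
      NbrOf? u = v g ~? u

      -- The at most two neighbours of `v_g` charged to an unlabelled edge: its near cases before
      -- and after `g` use vertices on opposite sides of the edge. Only `v_{g+1}` is counted apart.
      χ χ′ : ℕ → Fin n
      χ k with k <? g
      ... | yes _ = v k
      ... | no  _ = v (suc k)
      χ′ k with k <? g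
      ... | yes _ = v (pred k)
      ... | no  _ = v (suc (suc k))

      χ-< : ∀ {k} → k < g → χ k ≡ v k × χ′ k ≡ v (pred k)
      χ-< {k} k<g with k <? g
      ... | yes _  = refl , refl
      ... | no k≮g = contradiction k<g k≮g

      χ-≥ : ∀ {k} → g ≤ k → χ k ≡ v (suc k) × χ′ k ≡ v (suc (suc k))
      χ-≥ {k} g≤k with k <? g
      ... | yes k<g = contradiction g≤k (<⇒≱ k<g)
      ... | no  _   = refl , refl

      bound : List (Fin n)
      bound = v (suc g) ∷ map χ Os ++ map χ′ Os

      ∈χ : ∀ {k u} → k ∈ Os → χ k ≡ u → u ∈ bound
      ∈χ k∈ refl = there (∈-++⁺ˡ (∈-map⁺ χ k∈))

      ∈χ′ : ∀ {k u} → k ∈ Os → χ′ k ≡ u → u ∈ bound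
      ∈χ′ k∈ refl = there (∈-++⁺ʳ (map χ Os) (∈-map⁺ χ′ k∈))

      ∈-after : ∀ {l} → g ≤ l → suc l < N → v g ~ v (suc (suc l)) → v (suc (suc l)) ∈ bound
      ∈-after {l} g≤l l<N e with X? (suc l)
      ... | no ¬Xl = ∈χ (∈-Os l<N ¬Xl ¬Yl) (proj₁ (χ-≥ (m≤n⇒m≤1+n g≤l)))
        where
        ¬Yl : ¬ Y (suc l)
        ¬Yl Yl = X-before-Y (m≤n⇒m≤1+n g≤l) l<N Xg Yl e
      ... | yes Xl = ∈χ′ (∈-Os (<⇒≤ l<N) ¬Xl (λ Yl → ¬D (s≤s⁻¹ l<N) (Yl , Xl))) (proj₂ (χ-≥ g≤l))
        where
        ¬Xl : ¬ X l
        ¬Xl xl = ¬X⁺-after (s≤s g≤l) l<N xl e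

      ∈-before : ∀ {j} → j < g → v g ~ v j → v j ∈ bound
      ∈-before {j} j<g e with Y? j
      ... | no ¬Yj = ∈χ (∈-Os (<-trans j<g g<N) (λ Xj → ¬X-before j<g Xj (~s e)) ¬Yj) (proj₁ (χ-< j<g))
      ... | yes Yj = ∈χ′ (∈-Os (≤-<-trans j<g g<N) ¬Xj ¬Yj)
                         -- `j + 1` is not `g`, because `X g` holds.
                         (proj₂ (χ-< (≤∧≢⇒< j<g λ { refl → ¬Xj Xg })))
        where
        ¬Xj : ¬ X (suc j)
        ¬Xj Xj = ¬D (≤-trans j<g (s≤s⁻¹ g<N)) (Yj , Xj)
        ¬Yj : ¬ Y (suc j)
        ¬Yj Yj = Y⁻-before-X j<g g<N Yj Xg (~s e)

      Nbrs-⊆ : ∀ u → NbrOf u → u ∈ bound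
      Nbrs-⊆ u e with position u
      ... | j , j≤N , refl with <-cmp j (suc g)
      ... | tri≈ _ refl _ = here refl
      Nbrs-⊆ u e | suc (suc l) , j≤N , refl | tri> _ _ (s≤s g<l) = ∈-after (s≤s⁻¹ g<l) j≤N e
      Nbrs-⊆ u e | suc zero , j≤N , refl | tri> _ _ (s≤s ())
      Nbrs-⊆ u e | j , j≤N , refl | tri< (s≤s j≤g) _ _ with m≤n⇒m<n∨m≡n j≤g
      ... | inj₁ j<g  = ∈-before j<g e
      ... | inj₂ refl = contradiction e ~-irr

      degree-≤ : ∣ comprehension NbrOf? ∣ ≤ suc (o + o)
      degree-≤ = subst (∣ comprehension NbrOf? ∣ ≤_)
        (cong suc (trans (List.length-++ (map χ Os)) (cong₂ _+_ (List.length-map χ Os) (List.length-map χ′ Os))))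
        (∣comprehension∣-≤ NbrOf? bound Nbrs-⊆)

      -- Deleting its neighbours isolates `v_g`, while `x` survives by `x≁v`.
      degree-≥ : T * 2 ≤ ∣ comprehension NbrOf? ∣
      degree-≥ = tough (comprehension NbrOf?) 2 ≤-refl (Separated-≤-c NbrOf? G f f∉ f-sep)
        where
        f : Fin 2 → Fin n
        f zero       = v g
        f (suc zero) = x
        f∉ : ∀ i → ¬ NbrOf (f i)
        f∉ zero       e = ~-irr e
        f∉ (suc zero) e = x≁v (~s e)
        isolated : Separated NbrOf? G (v g) x
        isolated = isolated⇒Separated {P? = NbrOf?} (λ e → e) (v-< (≤-<-trans z≤n b<g) (<⇒≤ g<N) ∘ sym)
        f-sep : ∀ {i j} → i ≢ j → Separated NbrOf? G (f i) (f j)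
        f-sep {zero}     {zero}     i≢j = contradiction refl i≢j
        f-sep {zero}     {suc zero} _   = isolated
        f-sep {suc zero} {zero}     _   = Separated-sym {P? = NbrOf?} isolated
        f-sep {suc zero} {suc zero} i≢j = contradiction refl i≢j

    ¬Xg : ¬ X g
    ¬Xg Xg = 1+o+o≱ (≤-trans (degree-≥ Xg) (degree-≤ Xg))


  -- If no D-vertex exists, A and B are disjoint; removing the vertices in neither, together with the
  -- A-ends of the edges leading back from A to B, separates x from y.
  A B Cross Cut : ℕ → Set
  A i       = i < N × X i
  B zero    = ⊥
  B (suc k) = Y k
  Cross i   = ∃ λ b → b < i × suc b < i × Y b × v (suc b) ~ v i
  Cut i     = (¬ A i × ¬ B i) ⊎ (A i × Cross i)

  A? : U.Decidable A
  A? i = (i <? N) ×-dec X? i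

  B? : U.Decidable B
  B? zero    = no λ ()
  B? (suc k) = Y? k

  Cross? : U.Decidable Cross
  Cross? i = anyUpTo? (λ b → (suc b <? i) ×-dec Y? b ×-dec (v (suc b) ~? v i)) i

  Cut? : U.Decidable Cut
  Cut? i = (¬? (A? i) ×-dec ¬? (B? i)) ⊎-dec (A? i ×-dec Cross? i)

  pos : Fin n → ℕ
  pos u = proj₁ (position u)

  pos-≤ : ∀ u → pos u ≤ N
  pos-≤ u = proj₁ (proj₂ (position u))

  v-pos : ∀ u → v (pos u) ≡ u
  v-pos u = proj₂ (proj₂ (position u))

  pos-v : ∀ {k} → k ≤ N → pos (v k) ≡ k
  pos-v k≤N = v-injective (pos-≤ _) k≤N (v-pos _)

  InCut : Fin n → Set
  InCut u = Cut (pos u)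

  InCut? : U.Decidable InCut
  InCut? u = Cut? (pos u)

  Side : ℕ → Set
  Side i = A i × ¬ Cross i

  -- An edge from `A` forward to `B` is excluded by `X-before-Y`; one back to `B` would make `i`
  -- satisfy `Cross`.
  Side-closed : ∀ {i j} → j ≤ N → Side i → ¬ Cut j → v i ~ v j → Side j
  Side-closed {i} {j} j≤N ((i<N , Xi) , ¬Ci) ¬cut e with A? j | B? j
  ... | yes Aj | _      = Aj , λ Cj → ¬cut (inj₂ (Aj , Cj))
  ... | no ¬Aj | no ¬Bj = contradiction (inj₁ (¬Aj , ¬Bj)) ¬cut
  Side-closed {i} {suc k} k<N ((i<N , Xi) , ¬Ci) ¬cut e | no _ | yes Yk with <-cmp i (suc k)
  ... | tri< (s≤s i≤k) _ _ = ⊥-elim (X-before-Y i≤k k<N Xi Yk e)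
  ... | tri≈ _ refl _      = contradiction e ~-irr
  ... | tri> _ _ k<i       = contradiction (k , <⇒≤ k<i , k<i , Yk , ~s e) ¬Ci

  x-Side : Side 0
  x-Side = (s≤s z≤n , v-step (s≤s z≤n)) , λ { (_ , () , _) }

  y∉A : ¬ A N
  y∉A (N<N , _) = <-irrefl refl N<N

  x-y-separated : Separated InCut? G x y
  x-y-separated = separatedBy (Side ∘ pos) (subst Side (sym (pos-v z≤n)) x-Side)
    (λ side → y∉A (subst A (pos-v ≤-refl) (proj₁ side)))
    λ {a} {b} side _ ∉b e → Side-closed (pos-≤ b) side ∉b (subst₂ _~_ (sym (v-pos a)) (sym (v-pos b)) e)

  cut-tough : T * 2 ≤ ∣ comprehension InCut? ∣
  cut-tough = tough (comprehension InCut?) 2 ≤-refl (Separated-≤-c InCut? G f f∉ f-sep)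
    where
    f : Fin 2 → Fin n
    f zero       = x
    f (suc zero) = y
    x∉ : ¬ Cut 0
    x∉ (inj₁ (¬A , _))    = ¬A (proj₁ x-Side)
    x∉ (inj₂ (_ , cross)) = proj₂ x-Side cross
    y∉ : ¬ Cut N
    y∉ (inj₁ (_ , ¬B)) = ¬B (~s (v-step ≤-refl))
    y∉ (inj₂ (A , _))  = y∉A A
    f∉ : ∀ i → ¬ InCut (f i)
    f∉ zero       = x∉ ∘ subst Cut (pos-v z≤n)
    f∉ (suc zero) = y∉ ∘ subst Cut (pos-v ≤-refl)
    f-sep : ∀ {i j} → i ≢ j → Separated InCut? G (f i) (f j)
    f-sep {zero}     {zero}     i≢j = contradiction refl i≢j
    f-sep {zero}     {suc zero} _   = x-y-separated
    f-sep {suc zero} {zero}     _   = Separated-sym {P? = InCut?} x-y-separated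
    f-sep {suc zero} {suc zero} i≢j = contradiction refl i≢j

  Neither : ℕ → Set
  Neither i = ¬ X i × ¬ B i

  Neither? : U.Decidable Neither
  Neither? i = ¬? (X? i) ×-dec ¬? (B? i)

  -- The term bit (Y? m) accounts for the shift in B: vertex m + 1 is in B when edge m is labelled Y.
  Neither-step : ∀ {m p q} → suc m < N → p ≤ q + bit (Y? m) →
                 bit (Neither? (suc m)) + p ≤ (bit (O? (suc m)) + q) + bit (Y? (suc m))
  Neither-step {m} {p} {q} m<N le with X? (suc m) | Y? (suc m) | Y? m
  ... | yes Xm | yes Ym | _      = ⊥-elim (¬X∧Y m<N Xm Ym)
  ... | yes Xm | no _   | yes Ym = ⊥-elim (¬D (s≤s⁻¹ m<N) (Ym , Xm))
  ... | yes _  | no _   | no _   = le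
  ... | no _   | yes _  | yes _  = le
  ... | no _   | yes _  | no _   = ≤-trans (s≤s le) (≤-reflexive (sym (+-suc q 0)))
  ... | no _   | no _   | yes _  = ≤-trans le (≤-reflexive (+-suc q 0))
  ... | no _   | no _   | no _   = s≤s le

  -- An index in `Neither` is that of an unlabelled edge not preceded by Y, or starts a run of edges
  -- labelled Y. Without D-vertices such a run ends at an unlabelled edge, whose index is not in
  -- `Neither` and so pays for the run. A run still open at `m` is paid for by `bit (Y? m)`.
  count-Neither : ∀ m → m < N → length (filter Neither? (downFrom (suc m))) ≤
                                length (filter O? (downFrom (suc m))) + bit (Y? m)
  count-Neither zero m<N with X? 0
  ... | yes _  = z≤n
  ... | no ¬X₀ = contradiction (v-step m<N) ¬X₀
  count-Neither (suc m) m<N = subst₂ (λ p q → p ≤ q + bit (Y? (suc m)))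
    (sym (length-filter-∷ Neither? (suc m) (downFrom (suc m)))) (sym (length-filter-∷ O? (suc m) (downFrom (suc m))))
    (Neither-step m<N (count-Neither m (<⇒≤ m<N)))

  ∣cut∣-≤ : ∣ comprehension InCut? ∣ ≤ suc (o + o)
  ∣cut∣-≤ = ≤-trans (∣comprehension∣-≤ InCut? bound λ u cut → subst (_∈ bound) (v-pos u) (sub (pos-≤ u) cut)) (begin
    length bound                           ≡⟨ List.length-++ (map v Us) ⟩
    length (map v Us) + length (map v⁺ Os) ≡⟨ cong₂ _+_ (List.length-map v Us) (List.length-map v⁺ Os) ⟩
    length Us + o                          ≤⟨ +-monoˡ-≤ o (count-Neither M ≤-refl) ⟩
    o + bit (Y? M) + o                     ≤⟨ +-monoˡ-≤ o (+-monoʳ-≤ o (bit-≤1 (Y? M))) ⟩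
    o + 1 + o                              ≡⟨ cong (_+ o) (+-comm o 1) ⟩
    suc (o + o)                            ∎)
    where
    open ≤-Reasoning
    Us : List ℕ
    Us = filter Neither? (downFrom N)
    bound : List (Fin n)
    bound = map v Us ++ map v⁺ Os
    sub : ∀ {i} → i ≤ N → Cut i → v i ∈ bound
    sub {i} i≤N (inj₁ (¬A , ¬B)) with m≤n⇒m<n∨m≡n i≤N
    ... | inj₁ i<N  = ∈-++⁺ˡ (∈-map⁺ v (∈-filter⁺ Neither? (∈-downFrom⁺ i<N) ((λ Xi → ¬A (i<N , Xi)) , ¬B)))
    ... | inj₂ refl = contradiction (~s (v-step ≤-refl)) ¬B
    -- The edge entering this vertex is unlabelled: `CrossEdge` excludes X, and Y would make the
    -- vertex a D-vertex.
    sub {suc g} _ (inj₂ ((g<N , Xg) , b , _ , s≤s b<g , Yb , e)) = ∈-++⁺ʳ (map v Us)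
      (∈-map⁺ v⁺ (∈-Os (<⇒≤ g<N) (CrossEdge.¬Xg b<g (<⇒≤ g<N) Yb e) (λ Yg → ¬D (s≤s⁻¹ g<N) (Yg , Xg))))

  impossible : ⊥
  impossible = 1+o+o≱ (≤-trans cut-tough ∣cut∣-≤)

-- From rational to integral toughness

-- Unnormalised arithmetic computes directly, so facts about `fromℕ` are checked there. The `0`
-- encodes the denominator 1.
ℕ→ℚᵘ : ℕ → ℚᵘ
ℕ→ℚᵘ k = mkℚᵘ (ℤ.+ k) 0

toℚᵘ-fromℕ : ∀ k → toℚᵘ (fromℕ k) ≃ ℕ→ℚᵘ k
toℚᵘ-fromℕ k = ℚ.toℚᵘ-fromℚᵘ (ℕ→ℚᵘ k)

fromℕ-cancel-≤ : ∀ {a b} → fromℕ a ℚ.≤ fromℕ b → a ≤ b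
fromℕ-cancel-≤ {a} {b} le
  with *≤* l ← ℚᵘ.≤-respˡ-≃ (toℚᵘ-fromℕ a) (ℚᵘ.≤-respʳ-≃ (toℚᵘ-fromℕ b) (ℚ.toℚᵘ-mono-≤ le)) =
  ℤ.drop‿+≤+ (subst₂ ℤ._≤_ (ℤ.*-identityʳ (ℤ.+ a)) (ℤ.*-identityʳ (ℤ.+ b)) l)

fromℕ-+ : ∀ a b → fromℕ (a + b) ≡ fromℕ a ℚ.+ fromℕ b
fromℕ-+ a b = ℚ.toℚᵘ-injective (begin
  toℚᵘ (fromℕ (a + b))               ≈⟨ toℚᵘ-fromℕ (a + b) ⟩
  ℕ→ℚᵘ (a + b)                       ≡⟨ cong₂ (λ i j → mkℚᵘ (i ℤ.+ j) 0)
                                               (sym (ℤ.*-identityʳ (ℤ.+ a))) (sym (ℤ.*-identityʳ (ℤ.+ b))) ⟩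
  ℕ→ℚᵘ a ℚᵘ.+ ℕ→ℚᵘ b                 ≈⟨ ℚᵘ.+-cong (toℚᵘ-fromℕ a) (toℚᵘ-fromℕ b) ⟨
  toℚᵘ (fromℕ a) ℚᵘ.+ toℚᵘ (fromℕ b) ≈⟨ ℚ.toℚᵘ-homo-+ (fromℕ a) (fromℕ b) ⟨
  toℚᵘ (fromℕ a ℚ.+ fromℕ b)         ∎)
  where open ℚᵘ.≃-Reasoning

fromℕ-* : ∀ a b → fromℕ (a * b) ≡ fromℕ a ℚ.* fromℕ b
fromℕ-* a b = ℚ.toℚᵘ-injective (begin
  toℚᵘ (fromℕ (a * b))               ≈⟨ toℚᵘ-fromℕ (a * b) ⟩
  ℕ→ℚᵘ (a * b)                       ≡⟨ cong (λ i → mkℚᵘ i 0) (ℤ.pos-* a b) ⟩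
  ℕ→ℚᵘ a ℚᵘ.* ℕ→ℚᵘ b                 ≈⟨ ℚᵘ.*-cong (toℚᵘ-fromℕ a) (toℚᵘ-fromℕ b) ⟨
  toℚᵘ (fromℕ a) ℚᵘ.* toℚᵘ (fromℕ b) ≈⟨ ℚ.toℚᵘ-homo-* (fromℕ a) (fromℕ b) ⟨
  toℚᵘ (fromℕ a ℚ.* fromℕ b)         ∎)
  where open ℚᵘ.≃-Reasoning

-- T is max (4, n − d), so that all later counting takes place in ℕ.
integral-toughness : ∀ t → t ≥ fromℕ 4 → ∀ n d → fromℕ d ≥ fromℕ n - t →
                     ∃ λ T → 4 ≤ T × n ≤ d + T × fromℕ T ℚ.≤ t
integral-toughness t t≥4 n d d≥ with ≤-total n (d + 4)
... | inj₁ n≤ = 4 , ≤-refl , n≤ , t≥4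
... | inj₂ n≥ = n ∸ d , subst (_≤ n ∸ d) (m+n∸m≡n d 4) (∸-monoˡ-≤ d n≥) ,
  ≤-reflexive (sym d+T≡n) , (begin
    fromℕ T                               ≡⟨ ℚ.+-identityˡ (fromℕ T) ⟨
    0ℚ ℚ.+ fromℕ T                        ≡⟨ cong (ℚ._+ fromℕ T) (ℚ.+-inverseˡ (fromℕ d)) ⟨
    ℚ.- fromℕ d ℚ.+ fromℕ d ℚ.+ fromℕ T   ≡⟨ ℚ.+-assoc (ℚ.- fromℕ d) (fromℕ d) (fromℕ T) ⟩
    ℚ.- fromℕ d ℚ.+ (fromℕ d ℚ.+ fromℕ T) ≡⟨ cong (ℚ.- fromℕ d ℚ.+_) (trans (sym (fromℕ-+ d T)) (cong fromℕ d+T≡n)) ⟩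
    ℚ.- fromℕ d ℚ.+ fromℕ n               ≤⟨ ℚ.+-monoʳ-≤ (ℚ.- fromℕ d) n≤d+t ⟩
    ℚ.- fromℕ d ℚ.+ (fromℕ d ℚ.+ t)       ≡⟨ ℚ.+-assoc (ℚ.- fromℕ d) (fromℕ d) t ⟨
    ℚ.- fromℕ d ℚ.+ fromℕ d ℚ.+ t         ≡⟨ cong (ℚ._+ t) (ℚ.+-inverseˡ (fromℕ d)) ⟩
    0ℚ ℚ.+ t                              ≡⟨ ℚ.+-identityˡ t ⟩
    t                                     ∎)
  where
  open ℚ.≤-Reasoning
  T : ℕ
  T = n ∸ d
  d+T≡n : d + T ≡ n
  d+T≡n = m+[n∸m]≡n (≤-trans (m≤m+n d 4) n≥)
  n≤d+t : fromℕ n ℚ.≤ fromℕ d ℚ.+ t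
  n≤d+t = begin
    fromℕ n                   ≡⟨ ℚ.+-identityʳ (fromℕ n) ⟨
    fromℕ n ℚ.+ 0ℚ            ≡⟨ cong (fromℕ n ℚ.+_) (ℚ.+-inverseˡ t) ⟨
    fromℕ n ℚ.+ (ℚ.- t ℚ.+ t) ≡⟨ ℚ.+-assoc (fromℕ n) (ℚ.- t) t ⟨
    fromℕ n - t ℚ.+ t         ≤⟨ ℚ.+-monoˡ-≤ t d≥ ⟩
    fromℕ d ℚ.+ t             ∎

-- Accepts any lower bound `k` on the number of components, so exhibiting `k` separated vertices
-- suffices.
Tough⇒ : ∀ {n t T} {G : Graph n} → fromℕ T ℚ.≤ t → Tough t G →
         ∀ S k → 2 ≤ k → k ≤ c (G ─ S) → T * k ≤ ∣ S ∣
Tough⇒ {t = t} {T} {G} T≤t tough S k 2≤k k≤c = ≤-trans (*-monoʳ-≤ T k≤c) (fromℕ-cancel-≤ (begin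
  fromℕ (T * c (G ─ S))         ≡⟨ fromℕ-* T (c (G ─ S)) ⟩
  fromℕ T ℚ.* fromℕ (c (G ─ S)) ≤⟨ ℚ.*-monoʳ-≤-nonNeg (fromℕ (c (G ─ S))) T≤t ⟩
  t ℚ.* fromℕ (c (G ─ S))       ≤⟨ tough S (≤-trans 2≤k k≤c) ⟩
  fromℕ ∣ S ∣                   ∎))
  where
  open ℚ.≤-Reasoning
  instance
    c-nonNeg : NonNegative (fromℕ (c (G ─ S)))
    c-nonNeg = ℚ.normalize-nonNeg (c (G ─ S)) 1

theorem5 : (t : ℚ) → t ≥ fromℕ 4 →
    (n : ℕ) → n ℕ.≥ 3 →
    (G : Graph n) → Tough t G →
    (x y : Fin n) (x≢y : x ≢ y) → ¬ (Graph._~_ G x y) →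
    fromℕ (deg G x ℕ.+ deg G y) ≥ fromℕ n - t →
    Hamiltonian G ⇔ Hamiltonian (addEdge G x y x≢y)
theorem5 t t≥4 n n≥3 G tough x y x≢y x≁y deg≥ = mk⇔ add remove
  where
  add : Hamiltonian G → Hamiltonian (addEdge G x y x≢y)
  add (C , cover) = record
    { start = start ; rest = rest ; closed = Linked.map inj₁ closed ; distinct = distinct ; length≥3 = length≥3 } , cover
    where open Cycle C

  no-path : ¬ Hamiltonian G → ¬ ∃ λ L → Path G x y L × Spanning L
  no-path ¬ham (_ , [ _ ] , _) = x≢y refl
  no-path ¬ham (L , P@(_ ∷ Q) , spanning) with integral-toughness t t≥4 n (deg G x + deg G y) deg≥
  ... | T , 4≤T , n≤ , T≤t = Counting.impossible G n≥3 ¬ham (edges Q) (at P) (at-step P)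
    (subst Spanning (sym (segment-at P)) spanning) T (<⇒≤ 4≤T) (Tough⇒ {t = t} {T} {G} T≤t tough)
    (subst (λ u → n ≤ deg G x + deg G u + T) (sym (at-last P)) n≤)

  remove : Hamiltonian (addEdge G x y x≢y) → Hamiltonian G
  remove ham = decidable-stable (hamiltonian? G) λ ¬ham → no-path ¬ham (hamiltonianPath G x y x≢y ¬ham ham)
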